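{- Let $\varepsilon=\frac13-\frac1{48}$. Define $\theta_1=0$, $\theta_2=\frac{2\pi}{3}$, $\theta_3=\frac{4\pi}{3}$. Let $\theta_4$ be such that $(\cos\theta_4,\sin\theta_4)=\left(\frac13,\frac{\sqrt8}{3}\right)$, and let $\theta_5=\theta_4+\frac{2\pi}{3}$, $\theta_6=\theta_4+\frac{4\pi}{3}$. Let $\theta_7$ be such that $(\cos\theta_7,\sin\theta_7)=\left(\frac13,-\frac{\sqrt8}{3}\right)$, and let $\theta_8=\theta_7+\frac{2\pi}{3}$, $\theta_9=\theta_7+\frac{4\pi}{3}$. Then $\bigcup_{j=1}^{9}R_{\theta_j}E_{\varepsilon}=\mathbb{R}^2$.
   Context: For real $x$, $\|x\|$ denotes the distance from $x$ to the nearest integer. For $\varepsilon>0$, $E_{\varepsilon}=\{(x,y)\in\mathbb{R}^2:\|x\|\le\varepsilon\}$. $R_{\theta}$ denotes the counterclockwise rotation of the plane $\mathbb{R}^2$ by angle $\theta$ around the origin. -}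

module Defs where

open import Algebra.Apartness.Bundles using (HeytingField)
open import Algebra.Apartness.Structures using (IsHeytingField)
open import Algebra.Bundles using (CommutativeRing; Semiring)
open import Algebra.Core using (Op₁; Op₂)
import Algebra.Definitions.RawSemiring as RawSemiringDefinitions
open import Data.Fin.Base using (Fin; toℕ)
open import Data.Integer.Base as ℤ using (ℤ; +_; -[1+_])
open import Data.Nat.Base as ℕ using (ℕ; zero; suc; _!)
import Data.Nat.Properties as ℕₚ
open import Data.Product.Base using (∃-syntax; _×_; _,_; proj₁)
open import Data.Product.Relation.Binary.Pointwise.NonDependent using (Pointwise)
open import Data.Sum.Base using (_⊎_; inj₂)
open import Data.Vec.Base using (lookup; _∷_; [])
open import Level using (_⊔_) renaming (suc to lsuc)
open import Relation.Binary.Core using (Rel)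
open import Relation.Binary.Lattice.Structures using (IsLattice)
open import Relation.Binary.Structures using (IsStrictPartialOrder)
open import Relation.Nullary.Negation using (¬_)
open import Relation.Unary using (Pred; _∈_)

-- Ordered fields as in Definition 11.2.7 of the HoTT Book.  Neither
-- decidability nor trichotomy of the order is included, and x ≤ y is ¬ (y < x).
-- With trichotomy these are the usual ordered fields: _∨_ and _∧_ are then
-- the maximum and the minimum, and x # y is inequality.

record OrderedField c ℓ₁ ℓ₂ : Set (lsuc (c ⊔ ℓ₁ ⊔ ℓ₂)) where
  infix  8 -_
  infixl 7 _*_
  infixl 6 _+_
  infixl 5 _∨_ _∧_
  infix  4 _≈_ _<_ _≤_ _#_
  field
    Carrier : Set c
    _≈_     : Rel Carrier ℓ₁
    _<_     : Rel Carrier ℓ₂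
    _+_     : Op₂ Carrier
    _*_     : Op₂ Carrier
    -_      : Op₁ Carrier
    0#      : Carrier
    1#      : Carrier
    _∨_     : Op₂ Carrier
    _∧_     : Op₂ Carrier

  _≤_ : Rel Carrier ℓ₂
  x ≤ y = ¬ (y < x)

  _#_ : Rel Carrier ℓ₂
  x # y = x < y ⊎ y < x

  field
    isHeytingField       : IsHeytingField _≈_ _#_ _+_ _*_ -_ 0# 1#
    isStrictPartialOrder : IsStrictPartialOrder _≈_ _<_
    isLattice            : IsLattice _≈_ _≤_ _∨_ _∧_
    +-monoʳ-<            : ∀ z {x y} → x < y → z + x < z + y
    *-pos                : ∀ {x y} → 0# < x → 0# < y → 0# < x * y
    0<1                  : 0# < 1#

  heytingField : HeytingField c ℓ₁ ℓ₂
  heytingField = record { isHeytingField = isHeytingField }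

  open IsHeytingField isHeytingField public
    using (_-_; #⇒invertible; invertible⇒#; tight; isCommutativeRing)

  commutativeRing : CommutativeRing c ℓ₁
  commutativeRing = record { isCommutativeRing = isCommutativeRing }

  open RawSemiringDefinitions (Semiring.rawSemiring (CommutativeRing.semiring commutativeRing)) public
    using (_^_; sum) renaming (_×_ to _×ℕ_)

  fromℕ : ℕ → Carrier
  fromℕ n = n ×ℕ 1#

  fromℤ : ℤ → Carrier
  fromℤ (+ n)    = fromℕ n
  fromℤ -[1+ n ] = - fromℕ (suc n)

  ∣_∣ : Carrier → Carrier
  ∣ x ∣ = x ∨ - x

  IsCauchy : (ℕ → Carrier) → Set (c ⊔ ℓ₂)
  IsCauchy s = ∀ δ → 0# < δ →
    ∃[ N ] (∀ m n → N ℕ.≤ m → N ℕ.≤ n → ∣ s m - s n ∣ < δ)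

  _ConvergesTo_ : (ℕ → Carrier) → Carrier → Set (c ⊔ ℓ₂)
  s ConvergesTo l = ∀ δ → 0# < δ →
    ∃[ N ] (∀ n → N ℕ.≤ n → ∣ s n - l ∣ < δ)

-- The real numbers.  Classically an Archimedean, Cauchy complete ordered field
-- is the same as a Dedekind complete one, so these axioms determine ℝ up to
-- isomorphism; constructively the Bishop reals satisfy them.

record RealField c ℓ₁ ℓ₂ : Set (lsuc (c ⊔ ℓ₁ ⊔ ℓ₂)) where
  field
    orderedField : OrderedField c ℓ₁ ℓ₂

  open OrderedField orderedField public

  field
    archimedean : ∀ x → ∃[ n ] (x < fromℕ n)
    complete    : ∀ s → IsCauchy s → ∃[ l ] (s ConvergesTo l)

module Plane {c ℓ₁ ℓ₂} (ℝ : RealField c ℓ₁ ℓ₂) where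

  open RealField ℝ public
  private module CR = CommutativeRing commutativeRing
  private module SPO = IsStrictPartialOrder isStrictPartialOrder

  ----------------------------------------------------------------------
  -- Division by nonzero naturals

  0<fromℕ : ∀ n .{{_ : ℕ.NonZero n}} → 0# < fromℕ n
  0<fromℕ (suc zero)    = SPO.<-respʳ-≈ (CR.sym (CR.+-identityʳ 1#)) 0<1
  0<fromℕ (suc (suc n)) = SPO.trans 0<1
    (SPO.<-respˡ-≈ (CR.+-identityʳ 1#) (+-monoʳ-< 1# (0<fromℕ (suc n))))

  infixl 7 _÷_

  _÷_ : Carrier → (n : ℕ) → .{{ℕ.NonZero n}} → Carrier
  -- The library states invertibility for the difference fromℕ n - 0#.
  x ÷ n = x * proj₁ (#⇒invertible {fromℕ n} {0#} (inj₂ (0<fromℕ n)))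

  ----------------------------------------------------------------------
  -- Cosine, sine and π

  cosTerm : Carrier → ℕ → Carrier
  cosTerm x k = (- 1#) ^ k * x ^ (2 ℕ.* k) ÷ (2 ℕ.* k) !
    where instance _ = (2 ℕ.* k) ℕₚ.!≢0

  sinTerm : Carrier → ℕ → Carrier
  sinTerm x k = (- 1#) ^ k * x ^ (2 ℕ.* k ℕ.+ 1) ÷ (2 ℕ.* k ℕ.+ 1) !
    where instance _ = (2 ℕ.* k ℕ.+ 1) ℕₚ.!≢0

  _HasSum_ : (ℕ → Carrier) → Carrier → Set (c ⊔ ℓ₂)
  t HasSum l = (λ n → sum {n} (λ i → t (toℕ i))) ConvergesTo l

  IsCosine : (Carrier → Carrier) → Set (c ⊔ ℓ₂)
  IsCosine cos = ∀ x → cosTerm x HasSum cos x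

  IsSine : (Carrier → Carrier) → Set (c ⊔ ℓ₂)
  IsSine sin = ∀ x → sinTerm x HasSum sin x

  -- π is the least positive zero of the sine.
  IsPi : (sin : Carrier → Carrier) → Carrier → Set (c ⊔ ℓ₁ ⊔ ℓ₂)
  IsPi sin π = 0# < π × sin π ≈ 0# × (∀ x → 0# < x → sin x ≈ 0# → π ≤ x)

  _IsSqrtOf_ : Carrier → Carrier → Set (ℓ₁ ⊔ ℓ₂)
  r IsSqrtOf x = 0# ≤ r × r * r ≈ x

  ----------------------------------------------------------------------
  -- Distance to the nearest integer

  IsNearestInteger : Carrier → ℤ → Set ℓ₂
  IsNearestInteger x n = ∀ m → ∣ x - fromℤ n ∣ ≤ ∣ x - fromℤ m ∣

  -- ‖ x ‖≡ d is the graph of x ↦ ‖x‖.  It is a relation because a nearest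
  -- integer cannot be chosen constructively for every x.
  ‖_‖≡_ : Carrier → Carrier → Set (ℓ₁ ⊔ ℓ₂)
  ‖ x ‖≡ d = ∃[ n ] (IsNearestInteger x n × d ≈ ∣ x - fromℤ n ∣)

  ----------------------------------------------------------------------
  -- The plane

  Point : Set c
  Point = Carrier × Carrier

  _≈₂_ : Rel Point ℓ₁
  _≈₂_ = Pointwise _≈_ _≈_

  E : Carrier → Pred Point (c ⊔ ℓ₁ ⊔ ℓ₂)
  E ε (x , y) = ∃[ d ] (‖ x ‖≡ d × d ≤ ε)

  image : ∀ {ℓ} → (Point → Point) → Pred Point ℓ → Pred Point (c ⊔ ℓ₁ ⊔ ℓ)
  image f S p = ∃[ q ] (q ∈ S × f q ≈₂ p)

  rotation : (cos sin : Carrier → Carrier) → Carrier → Point → Point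
  rotation cos sin θ (x , y) =
    cos θ * x - sin θ * y , sin θ * x + cos θ * y

  angles : (π θ₄ θ₇ : Carrier) → Fin 9 → Carrier
  angles π θ₄ θ₇ = lookup
    ( 0# ∷ 2π/3      ∷ 4π/3
    ∷ θ₄ ∷ θ₄ + 2π/3 ∷ θ₄ + 4π/3
    ∷ θ₇ ∷ θ₇ + 2π/3 ∷ θ₇ + 4π/3
    ∷ [])
    where
    2π/3 4π/3 : Carrier
    2π/3 = fromℕ 2 * π ÷ 3
    4π/3 = fromℕ 4 * π ÷ 3

{-# OPTIONS --safe #-}

-- Let uⱼ be the abscissa of R₋θ p for θ = 2πj/3, and vⱼ, wⱼ the same for
-- θ₄ + 2πj/3 and θ₇ + 2πj/3.  Three directions at mutual angle 2π/3 have
-- abscissae with sum 0, so if none of the three is within ε of an integer, then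
-- they are all close to mⱼ + s/3 for integers mⱼ and one sign s = ±1, where
-- Σ mⱼ = −s.  If this happens for u, v and w alike, then replacing each abscissa in
-- 9 (vⱼ + wⱼ) − 6 uⱼ = 0 (from cos θ₄ = cos θ₇ = 1/3) by its mⱼ + s/3 gives integers
-- of absolute value below 2 that are ≡ s modulo 3, hence equal to s, where s is the
-- sign of u.  But summed over j these integers give 0, not 3s.
--
-- The values of cosine and sine at 2π/3 and 4π/3 enter only through 1 + ω + ω² = 0
-- for ω = cos (2π/3) + i sin (2π/3).  This follows from the addition theorem,
-- i.e. the Cauchy product of exponential series, because ω³ = cis(π)² = 1 and
-- sin (2π/3) ≠ 0 by the minimality of π.

module Submission where

open import Algebra.Apartness.Structures using (module IsHeytingField)
open import Algebra.Bundles using (CommutativeRing)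
open import Algebra.Core using (Op₁; Op₂)
import Algebra.Properties.Ring as RingProperties
import Algebra.Properties.Semiring.Mult as SemiringMult
import Algebra.Solver.Ring as RingSolver
open import Algebra.Solver.Ring.AlmostCommutativeRing using (fromCommutativeRing; _-Raw-AlmostCommutative⟶_)
open import Data.Empty using (⊥-elim)
open import Data.Fin.Base using (Fin; toℕ)
open import Data.Fin.Patterns
open import Data.Integer.Base as ℤ using (ℤ; +_; -[1+_])
import Data.Integer.Properties as ℤₚ
import Data.Integer.Solver as ℤ-Solver
open import Data.Maybe.Base using (map)
open import Data.Nat.Base using (nonZero)
open import Data.Nat.Base as ℕ using (ℕ; zero; suc; z≤n; s≤s; _!)
import Data.Nat.Properties as ℕₚ
open import Data.Product.Base using (_×_; _,_; proj₁; proj₂; ∃-syntax)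
open import Data.Product.Relation.Binary.Pointwise.NonDependent using (Pointwise; ×-isEquivalence)
open import Data.Sum.Base using (_⊎_; inj₁; inj₂; [_,_]′)
open import Data.Unit.Base using (tt)
open import Function.Base using (_∘_; id)
open import Relation.Binary.Core using (Rel)
open import Relation.Binary.Definitions using (tri<; tri≈; tri>)
open import Relation.Binary.Lattice.Structures using (module IsLattice)
import Relation.Binary.PropositionalEquality as ≡
open ≡ using (_≡_)
import Relation.Binary.Reasoning.Base.Triple as TripleReasoning
import Relation.Binary.Reasoning.Setoid as SetoidReasoning
open import Relation.Binary.Structures using (IsEquivalence; module IsStrictPartialOrder)
open import Relation.Nullary.Decidable using (dec⇒maybe)
open import Relation.Nullary.Negation using (¬_)
open import Relation.Unary using (⋃; _≐_; U)
open import Defs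

-- The constant 1/48 leaves a factor of two to spare. If all three abscissae of a triple were known
-- to be farther than 1/3 - 1/48 from every integer, their zero sum would put each within 2/48 of
-- its third; the weights 9, 9 and 6 turn this into an error below 24 · 2/48 = 1, while the
-- congruence modulo 3 tolerates any error below 2. The order of the reals is not decidable, so
-- whether an abscissa is that far away cannot be decided, but one can choose effectively between
-- two overlapping alternatives. The spare factor pays for the overlap: 2/48 becomes 4/48 and the
-- error bound becomes 2.
--
-- Cosine and sine are given only by their series. The Cauchy product is therefore split into an
-- exact identity between coefficients, proved by formal differentiation over any suitable ring, and
-- an estimate of what truncation leaves over.

-- Integers in a commutative ring

module IntegerCoefficients {c ℓ} (R : CommutativeRing c ℓ) where

  open CommutativeRing R
  open SemiringMult semiring using (×-homo-+; ×1-homo-*) renaming (_×_ to _×ℕ_)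
  open RingProperties ring
  open SetoidReasoning setoid

  fromℕ : ℕ → Carrier
  fromℕ n = n ×ℕ 1#

  -- The exponential series divides by every positive integer; the shifted index avoids a nonzero
  -- condition.
  InvertsSuccessors : (ℕ → Carrier) → Set ℓ
  InvertsSuccessors f = ∀ n → f n * fromℕ (suc n) ≈ 1#

  fromℤ : ℤ → Carrier
  fromℤ (+ n)    = fromℕ n
  fromℤ -[1+ n ] = - fromℕ (suc n)

  fromℤ-⊖ : ∀ m n → fromℤ (m ℤ.⊖ n) ≈ fromℕ m - fromℕ n
  fromℤ-⊖ m       zero    = sym (trans (+-congˡ -0#≈0#) (+-identityʳ _))
  fromℤ-⊖ zero    (suc n) = sym (+-identityˡ _)
  fromℤ-⊖ (suc m) (suc n) = begin
    fromℤ (suc m ℤ.⊖ suc n)                ≡⟨ ≡.cong fromℤ (ℤₚ.[1+m]⊖[1+n]≡m⊖n m n) ⟩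
    fromℤ (m ℤ.⊖ n)                        ≈⟨ fromℤ-⊖ m n ⟩
    fromℕ m - fromℕ n                      ≈⟨ +-congʳ (+-identityˡ _) ⟨
    0# + fromℕ m - fromℕ n                 ≈⟨ +-congʳ (+-congʳ (-‿inverseʳ 1#)) ⟨
    1# - 1# + fromℕ m - fromℕ n            ≈⟨ +-congʳ (+-assoc _ _ _) ⟩
    1# + (- 1# + fromℕ m) - fromℕ n        ≈⟨ +-congʳ (+-congˡ (+-comm _ _)) ⟩
    1# + (fromℕ m - 1#) - fromℕ n          ≈⟨ +-congʳ (+-assoc _ _ _) ⟨
    1# + fromℕ m - 1# - fromℕ n            ≈⟨ +-assoc _ _ _ ⟩
    1# + fromℕ m + (- 1# - fromℕ n)        ≈⟨ +-congˡ (-‿+-comm 1# (fromℕ n)) ⟩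
    fromℕ (suc m) - fromℕ (suc n)          ∎

  fromℤ-homo-+ : ∀ i j → fromℤ (i ℤ.+ j) ≈ fromℤ i + fromℤ j
  fromℤ-homo-+ (+ m)    (+ n)    = ×-homo-+ 1# m n
  fromℤ-homo-+ (+ m)    -[1+ n ] = fromℤ-⊖ m (suc n)
  fromℤ-homo-+ -[1+ m ] (+ n)    = trans (fromℤ-⊖ n (suc m)) (+-comm _ _)
  fromℤ-homo-+ -[1+ m ] -[1+ n ] = begin
    - fromℕ (suc (suc (m ℕ.+ n)))          ≡⟨ ≡.cong (λ k → - fromℕ (suc k)) (ℕₚ.+-suc m n) ⟨
    - fromℕ (suc m ℕ.+ suc n)              ≈⟨ -‿cong (×-homo-+ 1# (suc m) (suc n)) ⟩
    - (fromℕ (suc m) + fromℕ (suc n))      ≈⟨ -‿+-comm _ _ ⟨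
    - fromℕ (suc m) - fromℕ (suc n)        ∎

  fromℤ-homo-neg : ∀ i → fromℤ (ℤ.- i) ≈ - fromℤ i
  fromℤ-homo-neg (+ zero)  = sym -0#≈0#
  fromℤ-homo-neg (+ suc n) = refl
  fromℤ-homo-neg -[1+ n ]  = sym (-‿involutive _)

  fromℕ-homo-* : ∀ m j → fromℤ (+ m ℤ.* j) ≈ fromℕ m * fromℤ j
  fromℕ-homo-* m (+ n) = trans (reflexive (≡.cong fromℤ (≡.sym (ℤₚ.pos-* m n)))) (×1-homo-* m n)
  fromℕ-homo-* m -[1+ n ] = begin
    fromℤ (+ m ℤ.* -[1+ n ])           ≡⟨ ≡.cong fromℤ (ℤₚ.neg-distribʳ-* (+ m) (+ suc n)) ⟨
    fromℤ (ℤ.- (+ m ℤ.* + suc n))      ≈⟨ fromℤ-homo-neg (+ m ℤ.* + suc n) ⟩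
    - fromℤ (+ m ℤ.* + suc n)          ≈⟨ -‿cong (fromℕ-homo-* m (+ suc n)) ⟩
    - (fromℕ m * fromℕ (suc n))        ≈⟨ -‿distribʳ-* _ _ ⟩
    fromℕ m * - fromℕ (suc n)          ∎

  fromℤ-homo-* : ∀ i j → fromℤ (i ℤ.* j) ≈ fromℤ i * fromℤ j
  fromℤ-homo-* (+ m)    j = fromℕ-homo-* m j
  fromℤ-homo-* -[1+ m ] j = begin
    fromℤ (-[1+ m ] ℤ.* j)             ≡⟨ ≡.cong fromℤ (ℤₚ.neg-distribˡ-* (+ suc m) j) ⟨
    fromℤ (ℤ.- (+ suc m ℤ.* j))        ≈⟨ fromℤ-homo-neg (+ suc m ℤ.* j) ⟩
    - fromℤ (+ suc m ℤ.* j)            ≈⟨ -‿cong (fromℕ-homo-* (suc m) j) ⟩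
    - (fromℕ (suc m) * fromℤ j)        ≈⟨ -‿distribˡ-* _ _ ⟩
    - fromℕ (suc m) * fromℤ j          ∎

  -- fromℤ (+ 1) is 1# + 0#; interpreting the coefficient 1 as 1# itself
  -- lets con (+ 1) match a literal 1#.
  coefficient : ℤ → Carrier
  coefficient (+ 1) = 1#
  coefficient i     = fromℤ i

  coefficient≈fromℤ : ∀ i → coefficient i ≈ fromℤ i
  coefficient≈fromℤ (+ 0)           = refl
  coefficient≈fromℤ (+ 1)           = sym (+-identityʳ 1#)
  coefficient≈fromℤ (+ suc (suc n)) = refl
  coefficient≈fromℤ -[1+ n ]        = refl

  -- Equality in `R` may be undecidable, so the ring solver takes its coefficients from ℤ, where
  -- they can be compared. Numerals such as 48 then become constants of the solver.
  coefficientMorphism : ℤ.+-*-rawRing -Raw-AlmostCommutative⟶ fromCommutativeRing R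
  coefficientMorphism = record
    { ⟦_⟧    = coefficient
    ; +-homo = λ i j → via (i ℤ.+ j) (fromℤ-homo-+ i j) (+-cong (coefficient≈fromℤ i) (coefficient≈fromℤ j))
    ; *-homo = λ i j → via (i ℤ.* j) (fromℤ-homo-* i j) (*-cong (coefficient≈fromℤ i) (coefficient≈fromℤ j))
    ; -‿homo = λ i → via (ℤ.- i) (fromℤ-homo-neg i) (-‿cong (coefficient≈fromℤ i))
    ; 0-homo = refl
    ; 1-homo = refl
    }
    where
    via : ∀ i {x y} → fromℤ i ≈ y → x ≈ y → coefficient i ≈ x
    via i p q = trans (coefficient≈fromℤ i) (trans p (sym q))

  open RingSolver ℤ.+-*-rawRing (fromCommutativeRing R) coefficientMorphism
    (λ i j → map (λ i≡j → reflexive (≡.cong coefficient i≡j)) (dec⇒maybe (i ℤₚ.≟ j)))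
    public using (Polynomial; solve; _:=_; _:+_; _:*_; _:-_; :-_; con)

  con⁺ : ∀ {n} → ℕ → Polynomial n
  con⁺ n = con (+ n)

-- Complex numbers over a commutative ring

module ComplexNumbers {c ℓ} (R : CommutativeRing c ℓ) where

  open CommutativeRing R
  open IntegerCoefficients R

  ℂ : Set c
  ℂ = Carrier × Carrier

  infix  8 -ᶜ_
  infixl 7 _*ᶜ_
  infixl 6 _+ᶜ_
  infix  4 _≈ᶜ_

  _≈ᶜ_ : Rel ℂ ℓ
  _≈ᶜ_ = Pointwise _≈_ _≈_

  _+ᶜ_ _*ᶜ_ : Op₂ ℂ
  (a , b) +ᶜ (c , d) = a + c , b + d
  (a , b) *ᶜ (c , d) = a * c - b * d , a * d + b * c

  -ᶜ_ conj : Op₁ ℂ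
  -ᶜ (a , b) = - a , - b
  conj (a , b) = a , - b

  0ᶜ 1ᶜ : ℂ
  0ᶜ = 0# , 0#
  1ᶜ = 1# , 0#

  *ᶜ-cong : ∀ {z z′ w w′} → z ≈ᶜ z′ → w ≈ᶜ w′ → z *ᶜ w ≈ᶜ z′ *ᶜ w′
  *ᶜ-cong (p , q) (r , s) =
    +-cong (*-cong p r) (-‿cong (*-cong q s)) , +-cong (*-cong p s) (*-cong q r)

  *ᶜ-comm : ∀ z w → z *ᶜ w ≈ᶜ w *ᶜ z
  *ᶜ-comm (a , b) (c , d) =
    +-cong (*-comm a c) (-‿cong (*-comm b d)) , trans (+-comm _ _) (+-cong (*-comm b c) (*-comm a d))

  *ᶜ-assoc : ∀ z w v → z *ᶜ w *ᶜ v ≈ᶜ z *ᶜ (w *ᶜ v)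
  *ᶜ-assoc (a , b) (c , d) (e , f) =
    solve 6 (λ a b c d e f → (a :* c :- b :* d) :* e :- (a :* d :+ b :* c) :* f
      := a :* (c :* e :- d :* f) :- b :* (c :* f :+ d :* e)) refl a b c d e f ,
    solve 6 (λ a b c d e f → (a :* c :- b :* d) :* f :+ (a :* d :+ b :* c) :* e
      := a :* (c :* f :+ d :* e) :+ b :* (c :* e :- d :* f)) refl a b c d e f

  *ᶜ-distribʳ-+ᶜ : ∀ z w v → (w +ᶜ v) *ᶜ z ≈ᶜ w *ᶜ z +ᶜ v *ᶜ z
  *ᶜ-distribʳ-+ᶜ (a , b) (c , d) (e , f) =
    solve 6 (λ a b c d e f → (c :+ e) :* a :- (d :+ f) :* b
      := c :* a :- d :* b :+ (e :* a :- f :* b)) refl a b c d e f ,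
    solve 6 (λ a b c d e f → (c :+ e) :* b :+ (d :+ f) :* a
      := c :* b :+ d :* a :+ (e :* b :+ f :* a)) refl a b c d e f

  *ᶜ-identityˡ : ∀ z → 1ᶜ *ᶜ z ≈ᶜ z
  *ᶜ-identityˡ (a , b) =
    solve 2 (λ a b → con⁺ 1 :* a :- con⁺ 0 :* b := a) refl a b ,
    solve 2 (λ a b → con⁺ 1 :* b :+ con⁺ 0 :* a := b) refl a b

  private
    module ≈ᶜ = IsEquivalence (×-isEquivalence isEquivalence isEquivalence)

  complexRing : CommutativeRing c ℓ
  complexRing = record
    { Carrier = ℂ
    ; _≈_ = _≈ᶜ_
    ; _+_ = _+ᶜ_
    ; _*_ = _*ᶜ_
    ; -_ = -ᶜ_
    ; 0# = 0ᶜ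
    ; 1# = 1ᶜ
    ; isCommutativeRing = record
      { isRing = record
        { +-isAbelianGroup = record
          { isGroup = record
            { isMonoid = record
              { isSemigroup = record
                { isMagma = record
                  { isEquivalence = ×-isEquivalence isEquivalence isEquivalence
                  ; ∙-cong = λ (p , q) (r , s) → +-cong p r , +-cong q s
                  }
                ; assoc = λ (a , b) (c , d) (e , f) → +-assoc a c e , +-assoc b d f
                }
              ; identity = (λ (a , b) → +-identityˡ a , +-identityˡ b)
                         , (λ (a , b) → +-identityʳ a , +-identityʳ b)
              }
            ; inverse = (λ (a , b) → -‿inverseˡ a , -‿inverseˡ b)
                      , (λ (a , b) → -‿inverseʳ a , -‿inverseʳ b)
            ; ⁻¹-cong = λ (p , q) → -‿cong p , -‿cong q
            }
          ; comm = λ (a , b) (c , d) → +-comm a c , +-comm b d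
          }
        ; *-cong = *ᶜ-cong
        ; *-assoc = *ᶜ-assoc
        ; *-identity = *ᶜ-identityˡ , (λ z → ≈ᶜ.trans (*ᶜ-comm z 1ᶜ) (*ᶜ-identityˡ z))
        ; distrib = (λ z w v → ≈ᶜ.trans (*ᶜ-comm z (w +ᶜ v)) (≈ᶜ.trans (*ᶜ-distribʳ-+ᶜ z w v)
                      (+-cong (proj₁ (*ᶜ-comm w z)) (proj₁ (*ᶜ-comm v z))
                      , +-cong (proj₂ (*ᶜ-comm w z)) (proj₂ (*ᶜ-comm v z)))))
                  , *ᶜ-distribʳ-+ᶜ
        }
      ; *-comm = *ᶜ-comm
      }
    }

  conj-homo-* : ∀ z w → conj (z *ᶜ w) ≈ᶜ conj z *ᶜ conj w
  conj-homo-* (a , b) (c , d) =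
    solve 4 (λ a b c d → a :* c :- b :* d := a :* c :- (:- b) :* (:- d)) refl a b c d ,
    solve 4 (λ a b c d → :- (a :* d :+ b :* c) := a :* (:- d) :+ (:- b) :* c) refl a b c d

  module ℂ = CommutativeRing complexRing
  open IntegerCoefficients complexRing public using () renaming
    ( solve to solveᶜ; _:=_ to _:=ᶜ_; _:+_ to _:+ᶜ_; _:*_ to _:*ᶜ_; _:-_ to _:-ᶜ_; :-_ to :-ᶜ_; con to conᶜ
    ; fromℕ to fromℕᶜ )

-- Partial sums, Cauchy products and formal derivatives

module CauchyProduct {c ℓ} (R : CommutativeRing c ℓ) where

  open CommutativeRing R
  open IntegerCoefficients R
  open SetoidReasoning setoid

  partialSum : (ℕ → Carrier) → ℕ → Carrier
  partialSum a zero    = 0#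
  partialSum a (suc n) = a 0 + partialSum (a ∘ suc) n

  -- The coefficient Σ aᵢ bₙ₋ᵢ of a product of power series. Splitting off i = 0 makes every proof
  -- about it an induction in which the first factor is shifted.
  conv : (ℕ → Carrier) → (ℕ → Carrier) → ℕ → Carrier
  conv a b zero    = a 0 * b 0
  conv a b (suc n) = a 0 * b (suc n) + conv (a ∘ suc) b n

  derivative : (ℕ → Carrier) → ℕ → Carrier
  derivative a n = fromℕ (suc n) * a (suc n)

  partialSum-cong : ∀ {a b} → (∀ k → a k ≈ b k) → ∀ n → partialSum a n ≈ partialSum b n
  partialSum-cong p zero    = refl
  partialSum-cong p (suc n) = +-cong (p 0) (partialSum-cong (p ∘ suc) n)

  partialSum-+ : ∀ a b n → partialSum (λ k → a k + b k) n ≈ partialSum a n + partialSum b n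
  partialSum-+ a b zero    = sym (+-identityˡ 0#)
  partialSum-+ a b (suc n) = trans (+-congˡ (partialSum-+ (a ∘ suc) (b ∘ suc) n))
    (solve 4 (λ x y z w → x :+ y :+ (z :+ w) := x :+ z :+ (y :+ w)) refl _ _ _ _)

  partialSum-*ˡ : ∀ x a n → partialSum (λ k → x * a k) n ≈ x * partialSum a n
  partialSum-*ˡ x a zero    = sym (zeroʳ x)
  partialSum-*ˡ x a (suc n) = trans (+-congˡ (partialSum-*ˡ x (a ∘ suc) n)) (sym (distribˡ x _ _))

  -- In the triangle of products aᵢ bₖ with i + k ≤ n, the row i = 0 is a multiple of a partial sum
  -- of `b`, and the other rows form the smaller triangle of the shifted sequence.
  partialSum-conv : ∀ a b n →
    partialSum (conv a b) (suc n) ≈ a 0 * partialSum b (suc n) + partialSum (conv (a ∘ suc) b) n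
  partialSum-conv a b n = begin
    a 0 * b 0 + partialSum (λ k → a 0 * b (suc k) + conv (a ∘ suc) b k) n
      ≈⟨ +-congˡ (partialSum-+ (λ k → a 0 * b (suc k)) (conv (a ∘ suc) b) n) ⟩
    a 0 * b 0 + (partialSum (λ k → a 0 * b (suc k)) n + rest)
      ≈⟨ +-congˡ (+-congʳ (partialSum-*ˡ (a 0) (b ∘ suc) n)) ⟩
    a 0 * b 0 + (a 0 * partialSum (b ∘ suc) n + rest)
      ≈⟨ solve 4 (λ x y z r → x :* y :+ (x :* z :+ r) := x :* (y :+ z) :+ r) refl _ _ _ _ ⟩
    a 0 * partialSum b (suc n) + rest ∎
    where rest = partialSum (conv (a ∘ suc) b) n

  conv-cong : ∀ {a a′ b b′} → (∀ k → a k ≈ a′ k) → (∀ k → b k ≈ b′ k) → ∀ n → conv a b n ≈ conv a′ b′ n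
  conv-cong p q zero    = *-cong (p 0) (q 0)
  conv-cong p q (suc n) = +-cong (*-cong (p 0) (q (suc n))) (conv-cong (p ∘ suc) q n)

  conv-+ˡ : ∀ a a′ b n → conv (λ k → a k + a′ k) b n ≈ conv a b n + conv a′ b n
  conv-+ˡ a a′ b zero    = distribʳ _ _ _
  conv-+ˡ a a′ b (suc n) = trans (+-congˡ (conv-+ˡ (a ∘ suc) (a′ ∘ suc) b n))
    (solve 5 (λ x y z u v → (x :+ y) :* z :+ (u :+ v) := x :* z :+ u :+ (y :* z :+ v)) refl _ _ _ _ _)

  conv-*ˡ : ∀ x a b n → conv (λ k → x * a k) b n ≈ x * conv a b n
  conv-*ˡ x a b zero    = *-assoc x _ _
  conv-*ˡ x a b (suc n) = trans (+-congˡ (conv-*ˡ x (a ∘ suc) b n))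
    (solve 4 (λ x y z w → x :* y :* z :+ x :* w := x :* (y :* z :+ w)) refl _ _ _ _)

  conv-*ʳ : ∀ x a b n → conv a (λ k → x * b k) n ≈ x * conv a b n
  conv-*ʳ x a b zero    = solve 3 (λ x y z → y :* (x :* z) := x :* (y :* z)) refl _ _ _
  conv-*ʳ x a b (suc n) = trans (+-congˡ (conv-*ʳ x (a ∘ suc) b n))
    (solve 4 (λ x y z w → y :* (x :* z) :+ x :* w := x :* (y :* z :+ w)) refl _ _ _ _)

  -- The factor n + 2 is split as (n + 1) + 1. The induction hypothesis absorbs n + 1 for the
  -- shifted `a`, and the remaining 1 corrects the factors k + 1 of the shifted derivative to the k
  -- + 2 of the original one.
  leibniz : ∀ a b n →
    derivative (conv a b) n ≈ conv (derivative a) b n + conv a (derivative b) n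
  leibniz a b zero =
    solve 4 (λ a0 a1 b0 b1 → :1 :* (a0 :* b1 :+ a1 :* b0) := :1 :* a1 :* b0 :+ a0 :* (:1 :* b1))
      refl (a 0) (a 1) (b 0) (b 1)
    where :1 = con⁺ 1 :+ con⁺ 0
  leibniz a b (suc n) = begin
    fromℕ (suc (suc n)) * (a 0 * b (suc (suc n)) + s)
      ≈⟨ solve 4 (λ k x y s → (con⁺ 1 :+ k) :* (x :* y :+ s)
           := x :* ((con⁺ 1 :+ k) :* y) :+ (k :* s :+ s)) refl _ _ _ s ⟩
    a 0 * derivative b (suc n) + (fromℕ (suc n) * s + s)
      ≈⟨ +-congˡ (+-congʳ (leibniz (a ∘ suc) b n)) ⟩
    a 0 * derivative b (suc n) + (conv (derivative (a ∘ suc)) b n + t + (a 1 * b (suc n) + conv (a ∘ suc ∘ suc) b n))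
      ≈⟨ solve 5 (λ x y z u v → x :+ (y :+ z :+ (u :+ v)) := u :+ (v :+ y) :+ (x :+ z)) refl _ _ t _ _ ⟩
    a 1 * b (suc n) + (conv (a ∘ suc ∘ suc) b n + conv (derivative (a ∘ suc)) b n) + (a 0 * derivative b (suc n) + t)
      ≈⟨ +-congʳ (+-cong (*-congʳ (solve 1 (λ x → x := (con⁺ 1 :+ con⁺ 0) :* x) refl _))
           (trans (sym (conv-+ˡ _ _ b n))
           (conv-cong (λ k → solve 2 (λ m x → x :+ m :* x
             := (con⁺ 1 :+ m) :* x) refl (fromℕ (suc k)) _) (λ _ → refl) n))) ⟩
    conv (derivative a) b (suc n) + conv a (derivative b) (suc n) ∎
    where
    s = conv (a ∘ suc) b (suc n)
    t = conv (a ∘ suc) (derivative b) n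

-- The exponential series as a formal power series

module ExponentialSeries {c ℓ} (R : CommutativeRing c ℓ) (1/1+ : ℕ → CommutativeRing.Carrier R)
  (1/1+-inverse : IntegerCoefficients.InvertsSuccessors R 1/1+) where

  open CommutativeRing R
  open IntegerCoefficients R
  open CauchyProduct R
  open SetoidReasoning setoid

  expTerm : Carrier → ℕ → Carrier
  expTerm z zero    = 1#
  expTerm z (suc n) = 1/1+ n * (z * expTerm z n)

  expTerm-cong : ∀ {z w} → z ≈ w → ∀ n → expTerm z n ≈ expTerm w n
  expTerm-cong p zero    = refl
  expTerm-cong p (suc n) = *-congˡ (*-cong p (expTerm-cong p n))

  derivative-expTerm : ∀ z n → derivative (expTerm z) n ≈ z * expTerm z n
  derivative-expTerm z n = begin
    fromℕ (suc n) * (1/1+ n * (z * expTerm z n))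
      ≈⟨ solve 3 (λ k i x → k :* (i :* x) := i :* k :* x) refl _ _ _ ⟩
    1/1+ n * fromℕ (suc n) * (z * expTerm z n) ≈⟨ *-congʳ (1/1+-inverse n) ⟩
    1# * (z * expTerm z n)                     ≈⟨ *-identityˡ _ ⟩
    z * expTerm z n                            ∎

  -- On coefficients, f′ = z f is a recursion that determines the next coefficient once n + 1 can be
  -- inverted.
  expTerm-unique : ∀ z a → a 0 ≈ 1# → (∀ n → derivative a n ≈ z * a n) → ∀ n → a n ≈ expTerm z n
  expTerm-unique z a p q zero    = p
  expTerm-unique z a p q (suc n) = begin
    a (suc n)                            ≈⟨ *-identityˡ _ ⟨
    1# * a (suc n)                       ≈⟨ *-congʳ (1/1+-inverse n) ⟨
    1/1+ n * fromℕ (suc n) * a (suc n)   ≈⟨ *-assoc _ _ _ ⟩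
    1/1+ n * derivative a n              ≈⟨ *-congˡ (q n) ⟩
    1/1+ n * (z * a n)                   ≈⟨ *-congˡ (*-congˡ (expTerm-unique z a p q n)) ⟩
    expTerm z (suc n)                    ∎

  -- By the product rule the product of the two series solves f′ = (z + w) f. Uniqueness of the
  -- solution takes the place of the binomial theorem.
  conv-expTerm : ∀ z w n → conv (expTerm z) (expTerm w) n ≈ expTerm (z + w) n
  conv-expTerm z w = expTerm-unique (z + w) (conv (expTerm z) (expTerm w)) (*-identityˡ 1#) λ n → begin
    derivative (conv (expTerm z) (expTerm w)) n
      ≈⟨ leibniz (expTerm z) (expTerm w) n ⟩
    conv (derivative (expTerm z)) (expTerm w) n + conv (expTerm z) (derivative (expTerm w)) n
      ≈⟨ +-cong
           (trans (conv-cong (derivative-expTerm z) (λ _ → refl) n) (conv-*ˡ z (expTerm z) (expTerm w) n))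
           (trans (conv-cong (λ _ → refl) (derivative-expTerm w) n) (conv-*ʳ w (expTerm z) (expTerm w) n)) ⟩
    z * conv (expTerm z) (expTerm w) n + w * conv (expTerm z) (expTerm w) n
      ≈⟨ distribʳ _ _ _ ⟨
    (z + w) * conv (expTerm z) (expTerm w) n ∎

-- Inequalities in an ordered field without decidable order

module OrderedFieldProperties {c ℓ₁ ℓ₂} (F : OrderedField c ℓ₁ ℓ₂) where

  open OrderedField F
  open CommutativeRing commutativeRing public
    using ( refl; sym; trans; reflexive; +-cong; +-congˡ; +-congʳ; *-cong; *-congˡ; *-congʳ; -‿cong
          ; +-identityˡ; +-identityʳ; *-identityˡ; *-identityʳ; zeroˡ; zeroʳ; -‿inverseʳ; -‿inverseˡ
          ; +-comm; *-comm; +-assoc; *-assoc; distribˡ; distribʳ)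
  open IntegerCoefficients commutativeRing public
    using (solve; _:=_; _:+_; _:*_; _:-_; :-_; con; con⁺)
  open IsStrictPartialOrder isStrictPartialOrder public
    using (<-resp-≈; <-respʳ-≈; <-respˡ-≈)
    renaming (irrefl to <-irrefl; trans to <-trans; asym to <-asym)
  open IsLattice isLattice public
    using (x≤x∨y; y≤x∨y; ∨-least; antisym; isPreorder)
    renaming (trans to ≤-trans; refl to ≤-refl; reflexive to ≤-reflexive)

  private
    module IC = IntegerCoefficients commutativeRing

    fromℤ≈ : ∀ i → fromℤ i ≈ IC.fromℤ i
    fromℤ≈ (+ n)    = refl
    fromℤ≈ -[1+ n ] = refl

  fromℤ-homo-+ : ∀ i j → fromℤ (i ℤ.+ j) ≈ fromℤ i + fromℤ j
  fromℤ-homo-+ i j = trans (fromℤ≈ (i ℤ.+ j)) (trans (IC.fromℤ-homo-+ i j) (sym (+-cong (fromℤ≈ i) (fromℤ≈ j))))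

  fromℤ-homo-* : ∀ i j → fromℤ (i ℤ.* j) ≈ fromℤ i * fromℤ j
  fromℤ-homo-* i j = trans (fromℤ≈ (i ℤ.* j)) (trans (IC.fromℤ-homo-* i j) (sym (*-cong (fromℤ≈ i) (fromℤ≈ j))))

  fromℤ-homo-neg : ∀ i → fromℤ (ℤ.- i) ≈ - fromℤ i
  fromℤ-homo-neg i = trans (fromℤ≈ (ℤ.- i)) (trans (IC.fromℤ-homo-neg i) (sym (-‿cong (fromℤ≈ i))))

  -- The effective substitute for comparing `z` with a single bound. Cotransitivity of apartness
  -- gives four cases, and `x < y` redirects the two that point the wrong way.
  <-cotrans : ∀ {x y} → x < y → ∀ z → x < z ⊎ z < y
  <-cotrans x<y z with IsHeytingField.#-cotrans isHeytingField (inj₁ x<y) z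
  ... | inj₁ (inj₁ x<z) = inj₁ x<z
  ... | inj₁ (inj₂ z<x) = inj₂ (<-trans z<x x<y)
  ... | inj₂ (inj₁ z<y) = inj₂ z<y
  ... | inj₂ (inj₂ y<z) = inj₁ (<-trans x<y y<z)

  <⇒≤ : ∀ {x y} → x < y → x ≤ y
  <⇒≤ = <-asym

  <-≤-trans : ∀ {x y z} → x < y → y ≤ z → x < z
  <-≤-trans {z = z} x<y y≤z = [ id , ⊥-elim ∘ y≤z ]′ (<-cotrans x<y z)

  ≤-<-trans : ∀ {x y z} → x ≤ y → y < z → x < z
  ≤-<-trans {x} x≤y y<z = [ ⊥-elim ∘ x≤y , id ]′ (<-cotrans y<z x)

  module ≤-Reasoning = TripleReasoning isPreorder <-asym <-trans <-resp-≈ <⇒≤ <-≤-trans ≤-<-trans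

  private
    x+[y-x]≈y : ∀ x y → x + (y - x) ≈ y
    x+[y-x]≈y = solve 2 (λ x y → x :+ (y :- x) := y) refl

    -x+y≈y-x : ∀ x y → - x + y ≈ y - x
    -x+y≈y-x x y = +-comm (- x) y

  <⇒0<- : ∀ {x y} → x < y → 0# < y - x
  <⇒0<- {x} {y} x<y = <-respˡ-≈ (-‿inverseˡ x) (<-respʳ-≈ (-x+y≈y-x x y) (+-monoʳ-< (- x) x<y))

  0<-⇒< : ∀ {x y} → 0# < y - x → x < y
  0<-⇒< {x} {y} p = <-respˡ-≈ (+-identityʳ x) (<-respʳ-≈ (x+[y-x]≈y x y) (+-monoʳ-< x p))

  -- Used with p a positive combination of the hypotheses and a ring identity.
  <-by : ∀ {x y p} → 0# < p → p ≈ y - x → x < y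
  <-by 0<p p≈ = 0<-⇒< (<-respʳ-≈ p≈ 0<p)

  +-pos : ∀ {x y} → 0# < x → 0# < y → 0# < x + y
  +-pos {x} {y} 0<x 0<y = <-trans 0<x (<-respˡ-≈ (+-identityʳ x) (+-monoʳ-< x 0<y))

  0<fromℕ[1+n] : ∀ n → 0# < fromℕ (suc n)
  0<fromℕ[1+n] zero    = <-respʳ-≈ (sym (+-identityʳ 1#)) 0<1
  0<fromℕ[1+n] (suc n) = +-pos 0<1 (0<fromℕ[1+n] n)

  0≤fromℕ : ∀ n → 0# ≤ fromℕ n
  0≤fromℕ zero    = ≤-refl
  0≤fromℕ (suc n) = <⇒≤ (0<fromℕ[1+n] n)

  fromℕ-*-pos : ∀ n {x} → 0# < x → 0# < fromℕ (suc n) * x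
  fromℕ-*-pos n = *-pos (0<fromℕ[1+n] n)

  ≤⇒0≤- : ∀ {x y} → x ≤ y → 0# ≤ y - x
  ≤⇒0≤- {x} {y} x≤y p = x≤y (<-by (<⇒0<- p) (solve 2 (λ x y → con⁺ 0 :- (y :- x) := x :- y) refl x y))

  0≤-⇒≤ : ∀ {x y} → 0# ≤ y - x → x ≤ y
  0≤-⇒≤ {x} {y} p y<x = p (<-by (<⇒0<- y<x) (solve 2 (λ x y → x :- y := con⁺ 0 :- (y :- x)) refl x y))

  ≤-by : ∀ {x y p} → 0# ≤ p → p ≈ y - x → x ≤ y
  ≤-by 0≤p p≈ = 0≤-⇒≤ (≤-trans 0≤p (≤-reflexive p≈))

  fromℤ-mono-≤ : ∀ {i j} → i ℤ.≤ j → fromℤ i ≤ fromℤ j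
  fromℤ-mono-≤ {i} {j} i≤j = ≤-by (nonneg (ℤₚ.i≤j⇒0≤j-i i≤j))
    (trans (fromℤ-homo-+ j (ℤ.- i)) (+-congˡ (fromℤ-homo-neg i)))
    where
    nonneg : ∀ {k} → ℤ.0ℤ ℤ.≤ k → 0# ≤ fromℤ k
    nonneg (ℤ.+≤+ {n = n} _) = 0≤fromℕ n

  fromℤ-reflects-< : ∀ {i j} → fromℤ i < fromℤ j → i ℤ.< j
  fromℤ-reflects-< i<j = ℤₚ.≰⇒> (λ j≤i → fromℤ-mono-≤ j≤i i<j)

  +-mono-≤ : ∀ {x y z w} → x ≤ y → z ≤ w → x + z ≤ y + w
  +-mono-≤ {x} {y} {z} {w} x≤y z≤w y+w<x+z = z≤w (0<-⇒< (≤-<-trans (≤⇒0≤- x≤y)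
    (<-by (<⇒0<- y+w<x+z) (solve 4 (λ x y z w → x :+ z :- (y :+ w) := z :- w :- (y :- x)) refl x y z w))))

  +-nonneg : ∀ {x y} → 0# ≤ x → 0# ≤ y → 0# ≤ x + y
  +-nonneg 0≤x 0≤y = ≤-trans (≤-reflexive (sym (+-identityˡ 0#))) (+-mono-≤ 0≤x 0≤y)

  -- The goal is a negation, so x y < 0 may be assumed. A positive `x` would then force `y` to be 0,
  -- making the product 0; so `x` itself is 0, and the product is 0 again.
  *-nonneg : ∀ {x y} → 0# ≤ x → 0# ≤ y → 0# ≤ x * y
  *-nonneg {x} {y} 0≤x 0≤y xy<0 = <-irrefl (trans (*-congʳ x≈0) (zeroˡ y)) xy<0
    where
    x≈0 : x ≈ 0#
    x≈0 = antisym (λ 0<x → <-irrefl (trans (*-congˡ (y≈0 0<x)) (zeroʳ x)) xy<0) 0≤x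
      where
      y≈0 : 0# < x → y ≈ 0#
      y≈0 0<x = antisym (λ 0<y → <-asym (*-pos 0<x 0<y) xy<0) 0≤y

  *-monoˡ-≤ : ∀ {x y z} → 0# ≤ z → x ≤ y → z * x ≤ z * y
  *-monoˡ-≤ {x} {y} {z} 0≤z x≤y = ≤-by (*-nonneg 0≤z (≤⇒0≤- x≤y))
    (solve 3 (λ x y z → z :* (y :- x) := z :* y :- z :* x) refl x y z)

  *-mono-≤ : ∀ {x y z w} → 0# ≤ x → 0# ≤ w → x ≤ y → z ≤ w → x * z ≤ y * w
  *-mono-≤ {x} {y} {z} {w} 0≤x 0≤w x≤y z≤w = ≤-by
    (+-nonneg (*-nonneg 0≤x (≤⇒0≤- z≤w)) (*-nonneg 0≤w (≤⇒0≤- x≤y)))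
    (solve 4 (λ x y z w → x :* (w :- z) :+ w :* (y :- x) := y :* w :- x :* z) refl x y z w)

  -- For such a ratio a geometric series is bounded by twice its first term, so no closed formula
  -- for its sum has to be carried along.
  AtMostHalf : Carrier → Set ℓ₂
  AtMostHalf x = 0# ≤ x × x + x ≤ 1#

  double-nonneg⁻¹ : ∀ {x} → 0# ≤ x + x → 0# ≤ x
  double-nonneg⁻¹ p x<0 = p (<-trans (<-respʳ-≈ (+-identityʳ _) (+-monoʳ-< _ x<0)) x<0)

  square-nonneg : ∀ x → 0# ≤ x * x
  square-nonneg x x²<0 = <-irrefl (trans (*-cong x≈0 x≈0) (zeroˡ 0#)) x²<0
    where
    x≈0 : x ≈ 0#
    x≈0 = antisym (λ 0<x → <-asym (*-pos 0<x 0<x) x²<0)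
      (λ x<0 → <-asym (<-respʳ-≈ (solve 1 (λ x → (con⁺ 0 :- x) :* (con⁺ 0 :- x) := x :* x) refl x)
                        (*-pos (<⇒0<- x<0) (<⇒0<- x<0))) x²<0)

  sum-of-squares≈0⇒≈0 : ∀ {x y} → x * x + y * y ≈ 0# → x ≈ 0#
  sum-of-squares≈0⇒≈0 {x} {y} p = antisym
    (λ 0<x → <-irrefl (sym p) (<-≤-trans (*-pos 0<x 0<x) x²≤))
    (λ x<0 → <-irrefl (sym p) (<-≤-trans (*-pos (<⇒0<- x<0) (<⇒0<- x<0))
      (≤-trans (≤-reflexive (solve 1 (λ x → (con⁺ 0 :- x) :* (con⁺ 0 :- x) := x :* x) refl x)) x²≤)))
    where
    x²≤ : x * x ≤ x * x + y * y
    x²≤ = ≤-by (square-nonneg y) (solve 2 (λ x y → y := x :+ y :- x) refl (x * x) (y * y))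

  0<y∧x*y≈0⇒x≈0 : ∀ {x y} → 0# < y → x * y ≈ 0# → x ≈ 0#
  0<y∧x*y≈0⇒x≈0 {x} {y} 0<y xy≈0 = antisym
    (λ 0<x → <-irrefl (sym xy≈0) (*-pos 0<x 0<y))
    (λ x<0 → <-irrefl (sym -xy≈0) (*-pos (<⇒0<- x<0) 0<y))
    where
    -xy≈0 : (0# - x) * y ≈ 0#
    -xy≈0 = trans (solve 2 (λ x y → (con⁺ 0 :- x) :* y := con⁺ 0 :- x :* y) refl x y)
      (trans (+-congˡ (-‿cong xy≈0)) (-‿inverseʳ 0#))

  -- A mere negation does not provide an inverse of `x`. Instead, either strict sign of `y` would
  -- force `x` to be 0, and a number with neither strict sign is 0.
  *-cancel-≈0 : ∀ {x y} → ¬ (x ≈ 0#) → x * y ≈ 0# → y ≈ 0#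
  *-cancel-≈0 {x} {y} x≉0 xy≈0 = antisym
    (λ 0<y → x≉0 (0<y∧x*y≈0⇒x≈0 0<y xy≈0))
    (λ y<0 → x≉0 (0<y∧x*y≈0⇒x≈0 (<⇒0<- y<0) x[0-y]≈0))
    where
    x[0-y]≈0 : x * (0# - y) ≈ 0#
    x[0-y]≈0 = trans (solve 2 (λ x y → x :* (con⁺ 0 :- y) := con⁺ 0 :- x :* y) refl x y)
      (trans (+-congˡ (-‿cong xy≈0)) (-‿inverseʳ 0#))

  x≤∣x∣ : ∀ x → x ≤ ∣ x ∣
  x≤∣x∣ x = x≤x∨y x (- x)

  -x≤∣x∣ : ∀ x → - x ≤ ∣ x ∣
  -x≤∣x∣ x = y≤x∨y x (- x)

  ∣∣-least : ∀ {x y} → x ≤ y → - x ≤ y → ∣ x ∣ ≤ y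
  ∣∣-least = ∨-least

  0≤∣x∣ : ∀ x → 0# ≤ ∣ x ∣
  0≤∣x∣ x = double-nonneg⁻¹ (≤-trans (≤-reflexive (sym (-‿inverseʳ x))) (+-mono-≤ (x≤∣x∣ x) (-x≤∣x∣ x)))

  ∣∣-cong : ∀ {x y} → x ≈ y → ∣ x ∣ ≈ ∣ y ∣
  ∣∣-cong {x} {y} x≈y = antisym (half x≈y) (half (sym x≈y))
    where
    half : ∀ {x y} → x ≈ y → ∣ x ∣ ≤ ∣ y ∣
    half {x} {y} x≈y = ∣∣-least (≤-trans (≤-reflexive x≈y) (x≤∣x∣ y)) (≤-trans
      (≤-reflexive (-‿cong x≈y)) (-x≤∣x∣ y))

  ∣x+y∣≤∣x∣+∣y∣ : ∀ x y → ∣ x + y ∣ ≤ ∣ x ∣ + ∣ y ∣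
  ∣x+y∣≤∣x∣+∣y∣ x y = ∣∣-least (+-mono-≤ (x≤∣x∣ x) (x≤∣x∣ y))
    (≤-trans (≤-reflexive (solve 2 (λ x y → :- (x :+ y)
      := :- x :+ :- y) refl x y)) (+-mono-≤ (-x≤∣x∣ x) (-x≤∣x∣ y)))

  ∣-x∣≤∣x∣ : ∀ x → ∣ - x ∣ ≤ ∣ x ∣
  ∣-x∣≤∣x∣ x = ∣∣-least (-x≤∣x∣ x) (≤-trans (≤-reflexive (solve 1 (λ x → :- (:- x) := x) refl x)) (x≤∣x∣ x))

  0≤⇒∣x∣≤x : ∀ {x} → 0# ≤ x → ∣ x ∣ ≤ x
  0≤⇒∣x∣≤x {x} 0≤x = ∣∣-least ≤-refl (≤-by (+-nonneg 0≤x 0≤x) (solve 1 (λ x → x :+ x := x :- (:- x)) refl x))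

  -- Signs cannot be decided, so twice each difference ∣x∣∣y∣ ∓ x y is written as a sum of products
  -- of the nonnegative numbers ∣x∣ ± x and ∣y∣ ± y.
  ∣x*y∣≤∣x∣*∣y∣ : ∀ x y → ∣ x * y ∣ ≤ ∣ x ∣ * ∣ y ∣
  ∣x*y∣≤∣x∣*∣y∣ x y = ∣∣-least
    (0≤-⇒≤ (double-nonneg⁻¹ (≤-trans (+-nonneg (*-nonneg a-x b+y) (*-nonneg a+x b-y))
      (≤-reflexive (solve 4 (λ x y a b → (a :- x) :* (b :- (:- y)) :+ (a :- (:- x)) :* (b :- y)
        := (a :* b :- x :* y) :+ (a :* b :- x :* y)) refl x y ∣ x ∣ ∣ y ∣)))))
    (0≤-⇒≤ (double-nonneg⁻¹ (≤-trans (+-nonneg (*-nonneg a+x b+y) (*-nonneg a-x b-y))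
      (≤-reflexive (solve 4 (λ x y a b → (a :- (:- x)) :* (b :- (:- y)) :+ (a :- x) :* (b :- y)
        := (a :* b :- (:- (x :* y))) :+ (a :* b :- (:- (x :* y)))) refl x y ∣ x ∣ ∣ y ∣)))))
    where
    a-x = ≤⇒0≤- (x≤∣x∣ x)
    a+x = ≤⇒0≤- (-x≤∣x∣ x)
    b-y = ≤⇒0≤- (x≤∣x∣ y)
    b+y = ≤⇒0≤- (-x≤∣x∣ y)

-- The 1-norm of complex numbers

module ComplexNorm {c ℓ₁ ℓ₂} (F : OrderedField c ℓ₁ ℓ₂) where

  open OrderedField F
  open OrderedFieldProperties F
  open ComplexNumbers commutativeRing
  open ≤-Reasoning

  -- The 1-norm is used because it is submultiplicative and needs no square root.
  ∥_∥ : ℂ → Carrier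
  ∥ a , b ∥ = ∣ a ∣ + ∣ b ∣

  ∥∥-cong : ∀ {z w} → z ≈ᶜ w → ∥ z ∥ ≈ ∥ w ∥
  ∥∥-cong (p , q) = +-cong (∣∣-cong p) (∣∣-cong q)

  0≤∥z∥ : ∀ z → 0# ≤ ∥ z ∥
  0≤∥z∥ (a , b) = +-nonneg (0≤∣x∣ a) (0≤∣x∣ b)

  ∥z+w∥≤∥z∥+∥w∥ : ∀ z w → ∥ z +ᶜ w ∥ ≤ ∥ z ∥ + ∥ w ∥
  ∥z+w∥≤∥z∥+∥w∥ (a , b) (c , d) = ≤-trans (+-mono-≤ (∣x+y∣≤∣x∣+∣y∣ a c) (∣x+y∣≤∣x∣+∣y∣ b d))
    (≤-reflexive (solve 4 (λ a b c d → a :+ b :+ (c :+ d) := a :+ c :+ (b :+ d)) refl _ _ _ _))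

  ∥-z∥≤∥z∥ : ∀ z → ∥ -ᶜ z ∥ ≤ ∥ z ∥
  ∥-z∥≤∥z∥ (a , b) = +-mono-≤ (∣-x∣≤∣x∣ a) (∣-x∣≤∣x∣ b)

  ∥z*w∥≤∥z∥*∥w∥ : ∀ z w → ∥ z *ᶜ w ∥ ≤ ∥ z ∥ * ∥ w ∥
  ∥z*w∥≤∥z∥*∥w∥ (a , b) (c , d) = begin
    ∣ a * c - b * d ∣ + ∣ a * d + b * c ∣
      ≤⟨ +-mono-≤ (≤-trans (∣x+y∣≤∣x∣+∣y∣ _ _) (+-mono-≤ ≤-refl (∣-x∣≤∣x∣ _))) (∣x+y∣≤∣x∣+∣y∣ _ _) ⟩
    ∣ a * c ∣ + ∣ b * d ∣ + (∣ a * d ∣ + ∣ b * c ∣)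
      ≤⟨ +-mono-≤ (+-mono-≤ (∣x*y∣≤∣x∣*∣y∣ a c) (∣x*y∣≤∣x∣*∣y∣ b d))
        (+-mono-≤ (∣x*y∣≤∣x∣*∣y∣ a d) (∣x*y∣≤∣x∣*∣y∣ b c)) ⟩
    ∣ a ∣ * ∣ c ∣ + ∣ b ∣ * ∣ d ∣ + (∣ a ∣ * ∣ d ∣ + ∣ b ∣ * ∣ c ∣)
      ≈⟨ solve 4 (λ a b c d → a :* c :+ b :* d :+ (a :* d :+ b :* c) := (a :+ b) :* (c :+ d)) refl _ _ _ _ ⟩
    (∣ a ∣ + ∣ b ∣) * (∣ c ∣ + ∣ d ∣) ∎

-- Truncation error of Cauchy products under geometric bounds

module CauchyProductEstimate {c ℓ₁ ℓ₂} (F : OrderedField c ℓ₁ ℓ₂) (q : OrderedField.Carrier F)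
  (q-small : OrderedFieldProperties.AtMostHalf F q) where

  open OrderedField F
  open OrderedFieldProperties F
  open ComplexNumbers commutativeRing
  open ComplexNorm F
  open CauchyProduct complexRing using (partialSum; conv; partialSum-conv)
  open ≤-Reasoning

  private
    0≤q = proj₁ q-small
    q+q≤1 = proj₂ q-small

    -- Dropping the first term of a geometrically bounded sequence multiplies its constant by `q`;
    -- the inductions below let the constant vary in this way.
    shift : ∀ α n {x} → x ≤ α * q ^ suc n → x ≤ α * q * q ^ n
    shift α n p = ≤-trans p (≤-reflexive (sym (*-assoc α q (q ^ n))))

    αq+αq≤α : ∀ {α} → 0# ≤ α → α * q + α * q ≤ α
    αq+αq≤α {α} 0≤α = begin
      α * q + α * q ≈⟨ distribˡ α q q ⟨
      α * (q + q)   ≤⟨ *-monoˡ-≤ 0≤α q+q≤1 ⟩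
      α * 1#        ≈⟨ solve 1 (λ x → x :* con⁺ 1 := x) refl α ⟩
      α             ∎

  q^n-nonneg : ∀ n → 0# ≤ q ^ n
  q^n-nonneg zero    = <⇒≤ 0<1
  q^n-nonneg (suc n) = *-nonneg 0≤q (q^n-nonneg n)

  GeometricallyBounded : Carrier → (ℕ → ℂ) → Set _
  GeometricallyBounded β b = ∀ k → ∥ b k ∥ ≤ β * q ^ k

  ∥0∥≤ : ∀ {x} → 0# ≤ x → ∥ 0ᶜ ∥ ≤ x
  ∥0∥≤ {x} 0≤x = begin
    ∣ 0# ∣ + ∣ 0# ∣ ≤⟨ +-mono-≤ (0≤⇒∣x∣≤x ≤-refl) (0≤⇒∣x∣≤x ≤-refl) ⟩
    0# + 0#         ≈⟨ +-identityˡ 0# ⟩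
    0#              ≤⟨ 0≤x ⟩
    x               ∎

  -- The first term is at most `β`, and the tail, with constant `β * q`, contributes at most twice
  -- that, which is again at most `β`.
  ∥partialSum∥≤ : ∀ β b → 0# ≤ β → GeometricallyBounded β b → ∀ n → ∥ partialSum b n ∥ ≤ β + β
  ∥partialSum∥≤ β b 0≤β b≤ zero    = ∥0∥≤ (+-nonneg 0≤β 0≤β)
  ∥partialSum∥≤ β b 0≤β b≤ (suc n) = begin
    ∥ b 0 +ᶜ partialSum (b ∘ suc) n ∥     ≤⟨ ∥z+w∥≤∥z∥+∥w∥ _ _ ⟩
    ∥ b 0 ∥ + ∥ partialSum (b ∘ suc) n ∥
      ≤⟨ +-mono-≤ (b≤ 0) (∥partialSum∥≤ (β * q) (b ∘ suc) (*-nonneg 0≤β 0≤q) (λ k → shift β k (b≤ (suc k))) n) ⟩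
    β * 1# + (β * q + β * q)
      ≤⟨ +-mono-≤ (≤-reflexive (solve 1 (λ x → x :* con⁺ 1 := x) refl β)) (αq+αq≤α 0≤β) ⟩
    β + β ∎

  ∥partialSum-partialSum∥≤ : ∀ β b → 0# ≤ β → GeometricallyBounded β b → ∀ {m n} → m ℕ.≤ n →
    ∥ partialSum b n +ᶜ -ᶜ partialSum b m ∥ ≤ (β + β) * q ^ m
  ∥partialSum-partialSum∥≤ β b 0≤β b≤ {n = n} z≤n = begin
    ∥ partialSum b n +ᶜ -ᶜ 0ᶜ ∥
      ≈⟨ ∥∥-cong (solveᶜ 1 (λ z → z :-ᶜ conᶜ (+ 0) :=ᶜ z) ℂ.refl (partialSum b n)) ⟩
    ∥ partialSum b n ∥   ≤⟨ ∥partialSum∥≤ β b 0≤β b≤ n ⟩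
    β + β                ≈⟨ solve 1 (λ x → x := x :* con⁺ 1) refl _ ⟩
    (β + β) * 1#         ∎
  ∥partialSum-partialSum∥≤ β b 0≤β b≤ {suc m} {suc n} (s≤s m≤n) = begin
    ∥ partialSum b (suc n) +ᶜ -ᶜ partialSum b (suc m) ∥
      ≈⟨ ∥∥-cong (solveᶜ 3 (λ x y z → x :+ᶜ y :-ᶜ (x :+ᶜ z) :=ᶜ y :-ᶜ z)
           ℂ.refl (b 0) (partialSum (b ∘ suc) n) (partialSum (b ∘ suc) m)) ⟩
    ∥ partialSum (b ∘ suc) n +ᶜ -ᶜ partialSum (b ∘ suc) m ∥
      ≤⟨ ∥partialSum-partialSum∥≤ (β * q) (b ∘ suc) (*-nonneg 0≤β 0≤q) (λ k → shift β k (b≤ (suc k))) m≤n ⟩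
    (β * q + β * q) * q ^ m
      ≈⟨ solve 3 (λ x y z → (x :* y :+ x :* y) :* z := (x :+ x) :* (y :* z)) refl β q (q ^ m) ⟩
    (β + β) * q ^ suc m ∎

  -- The defect of the Cauchy product is Σ_{k<m} a k (B n − B (m−k)), where B
  -- are the partial sums of b; each summand is at most α q^k γ q^(m-k).
  ∥partialSum*partialSum-conv∥≤ : ∀ α γ a b → 0# ≤ α → 0# ≤ γ → GeometricallyBounded α a →
    (∀ {m n} → m ℕ.≤ n → ∥ partialSum b n +ᶜ -ᶜ partialSum b m ∥ ≤ γ * q ^ m) → ∀ {m n} → m ℕ.≤ n →
    ∥ partialSum a m *ᶜ partialSum b n +ᶜ -ᶜ partialSum (conv a b) m ∥ ≤ fromℕ m * (α * γ) * q ^ m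
  ∥partialSum*partialSum-conv∥≤ α γ a b 0≤α 0≤γ a≤ b≤ {n = n} z≤n = begin
    ∥ 0ᶜ *ᶜ partialSum b n +ᶜ -ᶜ 0ᶜ ∥
      ≈⟨ ∥∥-cong (solveᶜ 1 (λ z → :0 :*ᶜ z :-ᶜ :0 :=ᶜ :0) ℂ.refl (partialSum b n)) ⟩
    ∥ 0ᶜ ∥                      ≤⟨ ∥0∥≤ ≤-refl ⟩
    0#                          ≈⟨ solve 1 (λ x → con⁺ 0 := con⁺ 0 :* x :* con⁺ 1) refl (α * γ) ⟩
    fromℕ 0 * (α * γ) * q ^ 0   ∎
    where :0 = conᶜ (+ 0)
  ∥partialSum*partialSum-conv∥≤ α γ a b 0≤α 0≤γ a≤ b≤ {suc m} {suc n} (s≤s m≤n) = begin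
    ∥ (a 0 +ᶜ A′) *ᶜ B +ᶜ -ᶜ partialSum (conv a b) (suc m) ∥
      ≈⟨ ∥∥-cong (ℂ.+-congˡ {(a 0 +ᶜ A′) *ᶜ B} (ℂ.-‿cong (partialSum-conv a b m))) ⟩
    ∥ (a 0 +ᶜ A′) *ᶜ B +ᶜ -ᶜ (a 0 *ᶜ partialSum b (suc m) +ᶜ C′) ∥
      ≈⟨ ∥∥-cong (solveᶜ 5 (λ x y z u v → (x :+ᶜ y) :*ᶜ z :-ᶜ (x :*ᶜ u :+ᶜ v)
           :=ᶜ x :*ᶜ (z :-ᶜ u) :+ᶜ (y :*ᶜ z :-ᶜ v))
           ℂ.refl (a 0) A′ B (partialSum b (suc m)) C′) ⟩
    ∥ a 0 *ᶜ (B +ᶜ -ᶜ partialSum b (suc m)) +ᶜ (A′ *ᶜ B +ᶜ -ᶜ C′) ∥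
      ≤⟨ ∥z+w∥≤∥z∥+∥w∥ _ _ ⟩
    ∥ a 0 *ᶜ (B +ᶜ -ᶜ partialSum b (suc m)) ∥ + ∥ A′ *ᶜ B +ᶜ -ᶜ C′ ∥
      ≤⟨ +-mono-≤ (≤-trans (∥z*w∥≤∥z∥*∥w∥ _ _)
           (*-mono-≤ (0≤∥z∥ _) (*-nonneg 0≤γ (q^n-nonneg (suc m))) (a≤ 0) (b≤ (s≤s m≤n))))
           -- Only `m` decreases in the recursion while the partial sum `B` stays the same, hence
           -- two separate lengths in the statement.
           (∥partialSum*partialSum-conv∥≤ (α * q) γ (a ∘ suc) b (*-nonneg 0≤α 0≤q) 0≤γ
             (λ k → shift α k (a≤ (suc k))) b≤ (ℕₚ.m≤n⇒m≤1+n m≤n)) ⟩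
    α * 1# * (γ * q ^ suc m) + fromℕ m * (α * q * γ) * q ^ m
      ≈⟨ solve 5 (λ α γ q x m → α :* con⁺ 1 :* (γ :* (q :* x)) :+ m :* (α :* q :* γ) :* x
           := (con⁺ 1 :+ m) :* (α :* γ) :* (q :* x)) refl α γ q (q ^ m) (fromℕ m) ⟩
    fromℕ (suc m) * (α * γ) * q ^ suc m ∎
    where
    A′ = partialSum (a ∘ suc) m
    B = partialSum b (suc n)
    C′ = partialSum (conv (a ∘ suc) b) m

-- Division by integers and limits of sequences

module RealAnalysis {c ℓ₁ ℓ₂} (ℝ : RealField c ℓ₁ ℓ₂) where

  open Plane ℝ
  open OrderedFieldProperties orderedField
  open ComplexNumbers commutativeRing
  open ComplexNorm orderedField
  open CauchyProduct complexRing using (partialSum; partialSum-cong; conv)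
  open ≤-Reasoning

  ÷-*-cancel : ∀ x n .{{_ : ℕ.NonZero n}} → (x ÷ n) * fromℕ n ≈ x
  ÷-*-cancel x n with #⇒invertible {fromℕ n} {0#} (inj₂ (0<fromℕ n))
  ... | i , i*n≈1 , _ = begin-equality
    x * i * fromℕ n        ≈⟨ solve 3 (λ x i n → x :* i :* n := x :* (i :* (n :- con⁺ 0))) refl x i (fromℕ n) ⟩
    x * (i * (fromℕ n - 0#)) ≈⟨ *-congˡ i*n≈1 ⟩
    x * 1#                 ≈⟨ solve 1 (λ x → x :* con⁺ 1 := x) refl x ⟩
    x                      ∎

  fromℕ-*-cancelˡ : ∀ n .{{_ : ℕ.NonZero n}} {x y} → fromℕ n * x ≈ fromℕ n * y → x ≈ y
  fromℕ-*-cancelˡ n {x} {y} p = begin-equality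
    x                       ≈⟨ expand x ⟩
    (1# ÷ n) * (fromℕ n * x) ≈⟨ *-congˡ p ⟩
    (1# ÷ n) * (fromℕ n * y) ≈⟨ expand y ⟨
    y                       ∎
    where
    expand : ∀ x → x ≈ (1# ÷ n) * (fromℕ n * x)
    expand x = trans (sym (*-identityˡ x)) (trans (*-congʳ (sym (÷-*-cancel 1# n))) (*-assoc _ _ _))

  -- An invertible element is apart from 0 and so has a strict sign; a negative one would make its
  -- product with n negative instead of 1.
  1÷n-pos : ∀ n .{{_ : ℕ.NonZero n}} → 0# < 1# ÷ n
  1÷n-pos n = inverse-pos (0<fromℕ n) (÷-*-cancel 1# n)
    where
    inverse-pos : ∀ {x y} → 0# < y → x * y ≈ 1# → 0# < x
    inverse-pos {x} {y} 0<y xy≈1 with invertible⇒# {x} {0#} (y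
      , trans (solve 2 (λ x y → y :* (x :- con⁺ 0) := x :* y) refl x y) xy≈1
      , trans (solve 2 (λ x y → (x :- con⁺ 0) :* y := x :* y) refl x y) xy≈1)
    ... | inj₂ 0<x = 0<x
    ... | inj₁ x<0 = ⊥-elim (<-irrefl refl (<-trans 0<1 (<-by (*-pos (<⇒0<- x<0) 0<y)
      (trans (solve 2 (λ x y → (con⁺ 0 :- x) :* y := con⁺ 0 :- x :* y) refl x y) (+-congˡ (-‿cong xy≈1))))))

  ÷≈*1÷ : ∀ x n .{{_ : ℕ.NonZero n}} → x ÷ n ≈ x * (1# ÷ n)
  ÷≈*1÷ x n = *-congˡ (sym (*-identityˡ _))

  ÷-pos : ∀ {x} n .{{_ : ℕ.NonZero n}} → 0# < x → 0# < x ÷ n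
  ÷-pos {x} n 0<x = <-respʳ-≈ (sym (÷≈*1÷ x n)) (*-pos 0<x (1÷n-pos n))

  fromℕ-*-pos⁻¹ : ∀ n .{{_ : ℕ.NonZero n}} {x} → 0# < fromℕ n * x → 0# < x
  fromℕ-*-pos⁻¹ n {x} 0<nx = <-respʳ-≈
    (fromℕ-*-cancelˡ n (trans (solve 3 (λ n i y → n :* (i :* y)
      := i :* n :* y) refl (fromℕ n) (1# ÷ n) (fromℕ n * x))
      (trans (*-congʳ (÷-*-cancel 1# n)) (*-identityˡ _))))
    (*-pos (1÷n-pos n) 0<nx)

  fromℕ-mono-≤ : ∀ {m n} → m ℕ.≤ n → fromℕ m ≤ fromℕ n
  fromℕ-mono-≤ {n = n} z≤n = 0≤fromℕ n
  fromℕ-mono-≤ (s≤s m≤n)   = +-mono-≤ ≤-refl (fromℕ-mono-≤ m≤n)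

  -- The ratio is 1/4 because (n + 1)² splits into the four parts n², n, n and 1: by induction, n²
  -- qⁿ is an average of four numbers that are at most 1.
  q : Carrier
  q = 1# ÷ 4

  4q≈1 : fromℕ 4 * q ≈ 1#
  4q≈1 = trans (*-comm _ _) (÷-*-cancel 1# 4)

  0<q : 0# < q
  0<q = 1÷n-pos 4

  q-small : AtMostHalf q
  q-small = <⇒≤ 0<q , ≤-by (+-nonneg (<⇒≤ 0<q) (<⇒≤ 0<q))
    (trans (solve 1 (λ q → q :+ q := con⁺ 4 :* q :- (q :+ q)) refl q) (+-congʳ 4q≈1))

  open CauchyProductEstimate orderedField q q-small

  private
    ≤q⇒≤1 : ∀ {x y z w u} → x ≤ 1# → y ≤ 1# → z ≤ 1# → w ≤ 1# → u ≈ q * (x + y + z + w) → u ≤ 1#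
    ≤q⇒≤1 {x} {y} {z} {w} {u} p₁ p₂ p₃ p₄ eq = begin
      u                       ≈⟨ eq ⟩
      q * (x + y + z + w)     ≤⟨ *-monoˡ-≤ (<⇒≤ 0<q) (+-mono-≤ (+-mono-≤ (+-mono-≤ p₁ p₂) p₃) p₄) ⟩
      q * (1# + 1# + 1# + 1#) ≈⟨ solve 1 (λ q → q :* (:1 :+ :1 :+ :1 :+ :1) := con⁺ 4 :* q) refl q ⟩
      fromℕ 4 * q             ≈⟨ 4q≈1 ⟩
      1#                      ∎
      where :1 = con⁺ 1

  q^n≤1 : ∀ n → q ^ n ≤ 1#
  q^n≤1 zero    = ≤-refl
  q^n≤1 (suc n) = ≤q⇒≤1 (q^n≤1 n) 0≤1 0≤1 0≤1 (solve 2 (λ q x → q :* x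
    := q :* (x :+ :0 :+ :0 :+ :0)) refl q (q ^ n))
    where
    0≤1 = <⇒≤ 0<1
    :0 = con⁺ 0

  nq^n≤1 : ∀ n → fromℕ n * q ^ n ≤ 1#
  nq^n≤1 zero    = ≤-trans (≤-reflexive (zeroˡ _)) (<⇒≤ 0<1)
  nq^n≤1 (suc n) = ≤q⇒≤1 (nq^n≤1 n) (q^n≤1 n) 0≤1 0≤1
    (solve 3 (λ q x n → (con⁺ 1 :+ n) :* (q :* x) := q :* (n :* x :+ x :+ :0 :+ :0)) refl q (q ^ n) (fromℕ n))
    where
    0≤1 = <⇒≤ 0<1
    :0 = con⁺ 0

  n²q^n≤1 : ∀ n → fromℕ n * (fromℕ n * q ^ n) ≤ 1#
  n²q^n≤1 zero    = ≤-trans (≤-reflexive (zeroˡ _)) (<⇒≤ 0<1)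
  n²q^n≤1 (suc n) = ≤q⇒≤1 (n²q^n≤1 n) (nq^n≤1 n) (nq^n≤1 n) (q^n≤1 n)
    (solve 3 (λ q x n → (con⁺ 1 :+ n) :* ((con⁺ 1 :+ n) :* (q :* x))
      := q :* (n :* (n :* x) :+ n :* x :+ n :* x :+ x)) refl q (q ^ n) (fromℕ n))

  x÷2+x÷2≈x : ∀ x → x ÷ 2 + x ÷ 2 ≈ x
  x÷2+x÷2≈x x = trans (double (x ÷ 2)) (÷-*-cancel x 2)
    where
    double : ∀ x → x + x ≈ x * fromℕ 2
    double = solve 1 (λ x → x :+ x := x :* con⁺ 2) refl

  x÷2<x : ∀ {x} → 0# < x → x ÷ 2 < x
  x÷2<x {x} 0<x = <-by (÷-pos 2 0<x) (trans (cancel (x ÷ 2)) (+-congʳ (x÷2+x÷2≈x x)))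
    where
    cancel : ∀ x → x ≈ x + x - x
    cancel = solve 1 (λ x → x := x :+ x :- x) refl

  -- One-sided, since it serves for norms and other nonnegative sequences; comparison with a larger
  -- sequence is then immediate.
  EventuallySmall : (ℕ → Carrier) → Set _
  EventuallySmall f = ∀ δ → 0# < δ → ∃[ N ] (∀ n → N ℕ.≤ n → f n ≤ δ)

  small-≤ : ∀ {f g} → (∀ n → f n ≤ g n) → EventuallySmall g → EventuallySmall f
  small-≤ f≤g g↓0 δ 0<δ with g↓0 δ 0<δ
  ... | N , small = N , λ n N≤n → ≤-trans (f≤g n) (small n N≤n)

  small-+ : ∀ {f g} → EventuallySmall f → EventuallySmall g → EventuallySmall (λ n → f n + g n)
  small-+ f↓0 g↓0 δ 0<δ =
    let M , f≤ = f↓0 (δ ÷ 2) (÷-pos 2 0<δ)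
        N , g≤ = g↓0 (δ ÷ 2) (÷-pos 2 0<δ)
    in M ℕ.⊔ N , λ n M⊔N≤n → ≤-trans
      (+-mono-≤ (f≤ n (ℕₚ.m⊔n≤o⇒m≤o M N M⊔N≤n)) (g≤ n (ℕₚ.m⊔n≤o⇒n≤o M N M⊔N≤n)))
      (≤-reflexive (x÷2+x÷2≈x δ))

  small-* : ∀ {f x} → 0# ≤ x → EventuallySmall f → EventuallySmall (λ n → x * f n)
  small-* {f} {x} 0≤x f↓0 δ 0<δ with archimedean x
  ... | zero  , x<0 = ⊥-elim (0≤x x<0)
  ... | suc K , x<K =
    let N , f≤ = f↓0 (δ ÷ suc K) (÷-pos (suc K) 0<δ)
    in N , λ n N≤n → begin
      x * f n                     ≤⟨ *-mono-≤ 0≤x (<⇒≤ (÷-pos (suc K) 0<δ)) (<⇒≤ x<K) (f≤ n N≤n) ⟩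
      fromℕ (suc K) * (δ ÷ suc K) ≈⟨ *-comm _ _ ⟩
      (δ ÷ suc K) * fromℕ (suc K) ≈⟨ ÷-*-cancel δ (suc K) ⟩
      δ                           ∎

  -- If n qⁿ exceeded δ, then n² qⁿ ≤ 1 would give n δ ≤ 1, which fails as soon as n reaches a
  -- natural number above 1/δ.
  small-nq^n : EventuallySmall (λ n → fromℕ n * q ^ n)
  small-nq^n δ 0<δ with #⇒invertible {δ} {0#} (inj₂ 0<δ)
  ... | i , i*δ≈1 , _ with archimedean i
  ... | K , i<K = K , λ n K≤n δ<nq^n → <-irrefl refl (begin-strict
    fromℕ n * δ              ≤⟨ *-monoˡ-≤ (0≤fromℕ n) (<⇒≤ δ<nq^n) ⟩
    fromℕ n * (fromℕ n * q ^ n) ≤⟨ n²q^n≤1 n ⟩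
    1#                       ≈⟨ i*δ≈1 ⟨
    i * (δ - 0#)             <⟨ <-by (*-pos 0<δ (<⇒0<- i<K))
                                  (solve 3 (λ i δ k → δ :* (k :- i)
                                    := k :* δ :- i :* (δ :- con⁺ 0)) refl i δ (fromℕ K)) ⟩
    fromℕ K * δ              ≈⟨ *-comm _ _ ⟩
    δ * fromℕ K              ≤⟨ *-monoˡ-≤ (<⇒≤ 0<δ) (fromℕ-mono-≤ K≤n) ⟩
    δ * fromℕ n              ≈⟨ *-comm _ _ ⟩
    fromℕ n * δ              ∎)

  small-∘ : ∀ {f} {g : ℕ → ℕ} → (∀ n → n ℕ.≤ g n) → EventuallySmall f → EventuallySmall (f ∘ g)
  small-∘ n≤gn f↓0 δ 0<δ with f↓0 δ 0<δ
  ... | N , f≤ = N , λ n N≤n → f≤ _ (ℕₚ.≤-trans N≤n (n≤gn n))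

  small-const : ∀ {x} → EventuallySmall (λ _ → x) → x ≤ 0#
  small-const {x} x↓0 0<x =
    let N , x≤ = x↓0 (x ÷ 2) (÷-pos 2 0<x)
    in x≤ N ℕₚ.≤-refl (x÷2<x 0<x)

  ∣x∣≤0⇒x≈0 : ∀ {x} → ∣ x ∣ ≤ 0# → x ≈ 0#
  ∣x∣≤0⇒x≈0 {x} p = antisym (≤-trans (x≤∣x∣ x) p)
    (≤-by (≤⇒0≤- (≤-trans (-x≤∣x∣ x) p)) (solve 1 (λ x → con⁺ 0 :- (:- x) := x :- con⁺ 0) refl x))

  ∥z∥≤0⇒z≈0 : ∀ {z} → ∥ z ∥ ≤ 0# → z ≈ᶜ 0ᶜ
  ∥z∥≤0⇒z≈0 {a , b} p =
    ∣x∣≤0⇒x≈0 (≤-trans (≤-by (0≤∣x∣ b) (solve 2 (λ x y → y := x :+ y :- x) refl _ _)) p) ,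
    ∣x∣≤0⇒x≈0 (≤-trans (≤-by (0≤∣x∣ a) (solve 2 (λ x y → x := x :+ y :- y) refl _ _)) p)

  infix 4 _⟶_
  _⟶_ : (ℕ → ℂ) → ℂ → Set _
  s ⟶ l = EventuallySmall (λ n → ∥ s n +ᶜ -ᶜ l ∥)

  ⟶-replace : ∀ {s t l} → EventuallySmall (λ n → ∥ s n +ᶜ -ᶜ t n ∥) → s ⟶ l → t ⟶ l
  ⟶-replace {s} {t} {l} st sl = small-≤ (λ n → begin
    ∥ t n +ᶜ -ᶜ l ∥
      ≈⟨ ∥∥-cong (solveᶜ 3 (λ s t l → t :-ᶜ l :=ᶜ :-ᶜ (s :-ᶜ t) :+ᶜ (s :-ᶜ l)) ℂ.refl (s n) (t n) l) ⟩
    ∥ -ᶜ (s n +ᶜ -ᶜ t n) +ᶜ (s n +ᶜ -ᶜ l) ∥      ≤⟨ ∥z+w∥≤∥z∥+∥w∥ _ _ ⟩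
    ∥ -ᶜ (s n +ᶜ -ᶜ t n) ∥ + ∥ s n +ᶜ -ᶜ l ∥      ≤⟨ +-mono-≤ (∥-z∥≤∥z∥ _) ≤-refl ⟩
    ∥ s n +ᶜ -ᶜ t n ∥ + ∥ s n +ᶜ -ᶜ l ∥           ∎) (small-+ st sl)

  ⟶-cong : ∀ {s t l} → (∀ n → s n ≈ᶜ t n) → s ⟶ l → t ⟶ l
  ⟶-cong s≈t = small-≤ (λ n → ≤-reflexive (∥∥-cong (ℂ.+-congʳ (ℂ.sym (s≈t n)))))

  ⟶-unique : ∀ {s l m} → s ⟶ l → s ⟶ m → l ≈ᶜ m
  ⟶-unique {s} {l} {m} sl sm = x-y≈0⇒x≈y (∥z∥≤0⇒z≈0 (small-const (⟶-replace {s} {λ _ → l} sl sm)))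
    where
    x-y≈0⇒x≈y : l +ᶜ -ᶜ m ≈ᶜ 0ᶜ → l ≈ᶜ m
    x-y≈0⇒x≈y p = ℂ.trans (solveᶜ 2 (λ l m → l :=ᶜ l :-ᶜ m :+ᶜ m) ℂ.refl l m)
      (ℂ.trans (ℂ.+-congʳ p) (ℂ.+-identityˡ m))

  ⟶-* : ∀ {s t l m x} → (∀ n → ∥ t n ∥ ≤ x) → s ⟶ l → t ⟶ m → (λ n → s n *ᶜ t n) ⟶ l *ᶜ m
  ⟶-* {s} {t} {l} {m} {x} t≤x sl tm = small-≤ (λ n → begin
    ∥ s n *ᶜ t n +ᶜ -ᶜ (l *ᶜ m) ∥
      ≈⟨ ∥∥-cong (solveᶜ 4 (λ s t l m → s :*ᶜ t :-ᶜ l :*ᶜ m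
        :=ᶜ t :*ᶜ (s :-ᶜ l) :+ᶜ l :*ᶜ (t :-ᶜ m)) ℂ.refl (s n) (t n) l m) ⟩
    ∥ t n *ᶜ (s n +ᶜ -ᶜ l) +ᶜ l *ᶜ (t n +ᶜ -ᶜ m) ∥        ≤⟨ ∥z+w∥≤∥z∥+∥w∥ _ _ ⟩
    ∥ t n *ᶜ (s n +ᶜ -ᶜ l) ∥ + ∥ l *ᶜ (t n +ᶜ -ᶜ m) ∥     ≤⟨ +-mono-≤ (∥z*w∥≤∥z∥*∥w∥ _ _) (∥z*w∥≤∥z∥*∥w∥ _ _) ⟩
    ∥ t n ∥ * ∥ s n +ᶜ -ᶜ l ∥ + ∥ l ∥ * ∥ t n +ᶜ -ᶜ m ∥
      ≤⟨ +-mono-≤ (*-mono-≤ (0≤∥z∥ _) (0≤∥z∥ _) (t≤x n) ≤-refl) ≤-refl ⟩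
    x * ∥ s n +ᶜ -ᶜ l ∥ + ∥ l ∥ * ∥ t n +ᶜ -ᶜ m ∥         ∎)
    (small-+ (small-* (≤-trans (0≤∥z∥ (t 0)) (t≤x 0)) sl) (small-* (0≤∥z∥ l) tm))

  ⟶-conj : ∀ {s l} → s ⟶ l → (conj ∘ s) ⟶ conj l
  ⟶-conj {s} {l} = small-≤ λ n → ≤-trans
    (+-mono-≤ ≤-refl (≤-reflexive (∣∣-cong (solve 2 (λ x y → :- x :- (:- y) := :- (x :- y)) refl _ _))))
    (+-mono-≤ ≤-refl (∣-x∣≤∣x∣ _))

-- The complex exponential series and its real and imaginary terms

module ComplexExponential {c ℓ₁ ℓ₂} (ℝ : RealField c ℓ₁ ℓ₂) where

  open Plane ℝ
  open OrderedFieldProperties orderedField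
  open ComplexNumbers commutativeRing
  open ComplexNorm orderedField
  open RealAnalysis ℝ
  open CauchyProductEstimate orderedField q q-small
  open CauchyProduct complexRing using (partialSum; partialSum-cong; conv)
  open SemiringMult (CommutativeRing.semiring commutativeRing) using (×1-homo-*)
  open ≤-Reasoning

  real imaginary : Carrier → ℂ
  real x = x , 0#
  imaginary x = 0# , x

  1/1+ : ℕ → ℂ
  1/1+ n = real (1# ÷ suc n)

  fromℕᶜ≈real : ∀ n → fromℕᶜ n ≈ᶜ real (fromℕ n)
  fromℕᶜ≈real zero    = ℂ.refl
  fromℕᶜ≈real (suc n) = ℂ.trans (ℂ.+-congˡ {1ᶜ} (fromℕᶜ≈real n)) (refl , +-identityʳ 0#)

  real-* : ∀ x y → real x *ᶜ real y ≈ᶜ real (x * y)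
  real-* x y = solve 2 (λ x y → x :* y :- :0 :* :0 := x :* y) refl x y
             , solve 2 (λ x y → x :* :0 :+ :0 :* y := :0) refl x y
    where :0 = con⁺ 0

  1/1+-inverse : ∀ n → 1/1+ n *ᶜ fromℕᶜ (suc n) ≈ᶜ 1ᶜ
  1/1+-inverse n = ℂ.trans (ℂ.*-congˡ {1/1+ n} (fromℕᶜ≈real (suc n)))
    (ℂ.trans (real-* (1# ÷ suc n) (fromℕ (suc n))) (÷-*-cancel 1# (suc n) , refl))

  open ExponentialSeries complexRing 1/1+ 1/1+-inverse

  ∥real∥≤ : ∀ {x} → 0# ≤ x → ∥ real x ∥ ≤ x
  ∥real∥≤ {x} 0≤x = ≤-trans (+-mono-≤ (0≤⇒∣x∣≤x 0≤x) (0≤⇒∣x∣≤x ≤-refl)) (≤-reflexive (+-identityʳ x))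

  1÷-*≤q : ∀ {x} n → fromℕ 4 * x ≤ fromℕ (suc n) → (1# ÷ suc n) * x ≤ q
  1÷-*≤q {x} n 4x≤ = begin
    i * x                ≈⟨ *-congˡ (trans (sym (*-identityˡ x)) (*-congʳ (sym 4q≈1))) ⟩
    i * (fromℕ 4 * q * x)
      ≈⟨ solve 4 (λ i f q x → i :* (f :* q :* x) := i :* q :* (f :* x)) refl i (fromℕ 4) q x ⟩
    i * q * (fromℕ 4 * x)
      ≤⟨ *-monoˡ-≤ (*-nonneg (<⇒≤ (1÷n-pos (suc n))) (<⇒≤ 0<q)) 4x≤ ⟩
    i * q * fromℕ (suc n) ≈⟨ solve 3 (λ i q n → i :* q :* n := i :* n :* q) refl i q (fromℕ (suc n)) ⟩
    i * fromℕ (suc n) * q ≈⟨ *-congʳ (÷-*-cancel 1# (suc n)) ⟩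
    1# * q               ≈⟨ *-identityˡ q ⟩
    q                    ∎
    where i = 1# ÷ suc n

  -- Each initial term without control of the ratio costs a factor 1/q = 4 in the constant, plus its
  -- own norm.
  eventually-ratio≤q⇒bounded : ∀ K a → (∀ n → K ℕ.≤ n → ∥ a (suc n) ∥ ≤ q * ∥ a n ∥) →
    ∃[ α ] (0# ≤ α × GeometricallyBounded α a)
  eventually-ratio≤q⇒bounded zero a ratio = ∥ a 0 ∥ , 0≤∥z∥ (a 0) , bound
    where
    bound : GeometricallyBounded ∥ a 0 ∥ a
    bound zero    = ≤-reflexive (sym (trans (*-comm _ 1#) (*-identityˡ _)))
    bound (suc n) = begin
      ∥ a (suc n) ∥            ≤⟨ ratio n z≤n ⟩
      q * ∥ a n ∥              ≤⟨ *-monoˡ-≤ (<⇒≤ 0<q) (bound n) ⟩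
      q * (∥ a 0 ∥ * q ^ n)    ≈⟨ solve 3 (λ q x y → q :* (x :* y) := x :* (q :* y)) refl q ∥ a 0 ∥ (q ^ n) ⟩
      ∥ a 0 ∥ * q ^ suc n      ∎
  eventually-ratio≤q⇒bounded (suc K) a ratio
    with eventually-ratio≤q⇒bounded K (a ∘ suc) (λ n K≤n → ratio (suc n) (s≤s K≤n))
  ... | α , 0≤α , α-bound = fromℕ 4 * α + ∥ a 0 ∥ , +-nonneg 0≤4α (0≤∥z∥ (a 0)) , bound
    where
    0≤4α = *-nonneg (0≤fromℕ 4) 0≤α
    bound : GeometricallyBounded (fromℕ 4 * α + ∥ a 0 ∥) a
    bound zero    = ≤-by 0≤4α (solve 2 (λ x y → x := (x :+ y) :* con⁺ 1 :- y) refl (fromℕ 4 * α) ∥ a 0 ∥)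
    bound (suc n) = begin
      ∥ a (suc n) ∥              ≤⟨ α-bound n ⟩
      α * q ^ n                  ≈⟨ *-identityˡ _ ⟨
      1# * (α * q ^ n)           ≈⟨ *-congʳ 4q≈1 ⟨
      fromℕ 4 * q * (α * q ^ n)  ≤⟨ ≤-by (*-nonneg (0≤∥z∥ (a 0)) (q^n-nonneg (suc n)))
        (solve 5 (λ f q α x y → y :* (q :* x) := (f :* α :+ y) :* (q :* x) :- f :* q :* (α :* x)) refl
          (fromℕ 4) q α (q ^ n) ∥ a 0 ∥) ⟩
      (fromℕ 4 * α + ∥ a 0 ∥) * q ^ suc n ∎

  -- Consecutive terms have norm ratio at most ∥z∥/(n + 1), which is below 1/4 once n passes a
  -- natural number above 4∥z∥.
  expTerm-bounded : ∀ z → ∃[ α ] (0# ≤ α × GeometricallyBounded α (expTerm z))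
  expTerm-bounded z =
    let K , 4z<K = archimedean (fromℕ 4 * ∥ z ∥)
    in eventually-ratio≤q⇒bounded K (expTerm z) λ n K≤n → begin
      ∥ 1/1+ n *ᶜ (z *ᶜ expTerm z n) ∥       ≤⟨ ∥z*w∥≤∥z∥*∥w∥ _ _ ⟩
      ∥ 1/1+ n ∥ * ∥ z *ᶜ expTerm z n ∥
        ≤⟨ *-mono-≤ (0≤∥z∥ (1/1+ n)) (*-nonneg (0≤∥z∥ z) (0≤∥z∥ (expTerm z n)))
             (∥real∥≤ (<⇒≤ (1÷n-pos (suc n)))) (∥z*w∥≤∥z∥*∥w∥ _ _) ⟩
      (1# ÷ suc n) * (∥ z ∥ * ∥ expTerm z n ∥) ≈⟨ *-assoc _ _ _ ⟨
      (1# ÷ suc n) * ∥ z ∥ * ∥ expTerm z n ∥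
        ≤⟨ *-mono-≤ (*-nonneg (<⇒≤ (1÷n-pos (suc n))) (0≤∥z∥ z)) (0≤∥z∥ (expTerm z n))
             (1÷-*≤q n (≤-trans (<⇒≤ 4z<K) (fromℕ-mono-≤ (ℕₚ.m≤n⇒m≤1+n K≤n)))) ≤-refl ⟩
      q * ∥ expTerm z n ∥                    ∎

  expSum : ℂ → ℕ → ℂ
  expSum z = partialSum (expTerm z)

  expSum-bounded : ∀ z → ∃[ x ] (∀ n → ∥ expSum z n ∥ ≤ x)
  expSum-bounded z =
    let α , 0≤α , α-bound = expTerm-bounded z
    in α + α , ∥partialSum∥≤ α (expTerm z) 0≤α α-bound

  -- The convolution has exactly the terms of the series for z + w, so the difference is the
  -- truncation defect, at most a constant times n qⁿ.
  expSum-* : ∀ z w → EventuallySmall (λ n → ∥ expSum z n *ᶜ expSum w n +ᶜ -ᶜ expSum (z +ᶜ w) n ∥)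
  expSum-* z w =
    let α , 0≤α , α-bound = expTerm-bounded z
        β , 0≤β , β-bound = expTerm-bounded w
        0≤2β = +-nonneg 0≤β 0≤β
    in small-≤ (λ n → begin
      ∥ expSum z n *ᶜ expSum w n +ᶜ -ᶜ expSum (z +ᶜ w) n ∥
        ≈⟨ ∥∥-cong (ℂ.+-congˡ {expSum z n *ᶜ expSum w n} (ℂ.-‿cong (partialSum-cong (conv-expTerm z w) n))) ⟨
      ∥ expSum z n *ᶜ expSum w n +ᶜ -ᶜ partialSum (conv (expTerm z) (expTerm w)) n ∥
        ≤⟨ ∥partialSum*partialSum-conv∥≤ α (β + β) (expTerm z) (expTerm w) 0≤α 0≤2β α-bound
             (∥partialSum-partialSum∥≤ β (expTerm w) 0≤β β-bound) (ℕₚ.≤-refl {n}) ⟩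
      fromℕ n * (α * (β + β)) * q ^ n
        ≈⟨ solve 3 (λ n x y → n :* x :* y := x :* (n :* y)) refl (fromℕ n) (α * (β + β)) (q ^ n) ⟩
      α * (β + β) * (fromℕ n * q ^ n) ∎)
      (small-* (*-nonneg 0≤α 0≤2β) small-nq^n)

  expTerm-conj : ∀ z n → conj (expTerm z n) ≈ᶜ expTerm (conj z) n
  expTerm-conj z zero    = refl , solve 0 (:- con⁺ 0 := con⁺ 0) refl
  expTerm-conj z (suc n) = ℂ.trans (conj-homo-* (1/1+ n) (z *ᶜ expTerm z n))
    (*ᶜ-cong {conj (1/1+ n)} {1/1+ n} (refl , solve 0 (:- con⁺ 0 := con⁺ 0) refl)
      (ℂ.trans (conj-homo-* z (expTerm z n)) (ℂ.*-congˡ {conj z} (expTerm-conj z n))))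

  partialSum-conj : ∀ a n → conj (partialSum a n) ≈ᶜ partialSum (conj ∘ a) n
  partialSum-conj a zero    = refl , solve 0 (:- con⁺ 0 := con⁺ 0) refl
  partialSum-conj a (suc n) = ℂ.trans (refl , solve 2 (λ x y → :- (x :+ y) := :- x :+ :- y) refl _ _)
    (ℂ.+-congˡ {conj (a 0)} (partialSum-conj (a ∘ suc) n))

  expSum-0 : ∀ n → expSum 0ᶜ (suc n) ≈ᶜ 1ᶜ
  expSum-0 n = ℂ.trans (ℂ.+-congˡ {1ᶜ} (ℂ.trans (partialSum-cong vanish n) (partialSum-0 n))) (ℂ.+-identityʳ 1ᶜ)
    where
    vanish : ∀ k → expTerm 0ᶜ (suc k) ≈ᶜ 0ᶜ
    vanish k = ℂ.trans (ℂ.*-congˡ {1/1+ k} (ℂ.zeroˡ (expTerm 0ᶜ k))) (ℂ.zeroʳ (1/1+ k))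
    partialSum-0 : ∀ n → partialSum (λ _ → 0ᶜ) n ≈ᶜ 0ᶜ
    partialSum-0 zero    = ℂ.refl
    partialSum-0 (suc n) = ℂ.trans (ℂ.+-identityˡ _) (partialSum-0 n)

  -- scaledPower s x n is s xⁿ / n!, so that cosTerm x k and sinTerm x k are the
  -- cases n = 2k and n = 2k + 1 with s = (−1)ᵏ.
  scaledPower : Carrier → Carrier → ℕ → Carrier
  scaledPower s x n = _÷_ (s * x ^ n) (n !) {{n ℕₚ.!≢0}}

  -- The recursion of `expTerm`. Both sides are compared after multiplication by (n + 1)!, which
  -- clears all quotients.
  scaledPower-suc : ∀ s x n → (1# ÷ suc n) * (x * scaledPower s x n) ≈ scaledPower s x (suc n)
  scaledPower-suc s x n = fromℕ-*-cancelˡ (suc n !) (begin-equality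
    fromℕ (suc n !) * (i * (x * t))
      ≈⟨ *-congʳ (×1-homo-* (suc n) (n !)) ⟩
    fromℕ (suc n) * fromℕ (n !) * (i * (x * t))
      ≈⟨ solve 5 (λ m f i x t → m :* f :* (i :* (x :* t))
        := x :* (i :* m) :* (t :* f)) refl (fromℕ (suc n)) (fromℕ (n !)) i x t ⟩
    x * (i * fromℕ (suc n)) * (t * fromℕ (n !))
      ≈⟨ *-cong (*-congˡ (÷-*-cancel 1# (suc n))) (÷-*-cancel (s * x ^ n) (n !)) ⟩
    x * 1# * (s * x ^ n)
      ≈⟨ solve 3 (λ x s y → x :* con⁺ 1 :* (s :* y) := s :* (x :* y)) refl x s (x ^ n) ⟩
    s * x ^ suc n
      ≈⟨ ÷-*-cancel (s * x ^ suc n) (suc n !) ⟨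
    scaledPower s x (suc n) * fromℕ (suc n !)
      ≈⟨ *-comm _ _ ⟩
    fromℕ (suc n !) * scaledPower s x (suc n) ∎)
    where
    instance
      _ = n ℕₚ.!≢0
      _ = suc n ℕₚ.!≢0
    i = 1# ÷ suc n
    t = scaledPower s x n

  scaledPower-neg : ∀ s x n → - scaledPower s x n ≈ scaledPower (- 1# * s) x n
  scaledPower-neg s x n =
    solve 3 (λ s y i → :- (s :* y :* i) := :- con⁺ 1 :* s :* y :* i) refl s (x ^ n) _

  scaledPower-0 : ∀ x → scaledPower 1# x 0 ≈ 1#
  scaledPower-0 x = fromℕ-*-cancelˡ 1 (begin-equality
    fromℕ 1 * scaledPower 1# x 0 ≈⟨ *-comm _ _ ⟩
    scaledPower 1# x 0 * fromℕ 1 ≈⟨ ÷-*-cancel (1# * 1#) 1 ⟩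
    1# * 1#                      ≈⟨ *-congʳ (sym (+-identityʳ 1#)) ⟩
    fromℕ 1 * 1#                 ∎)

  sinTerm≡ : ∀ x k → sinTerm x k ≡ scaledPower ((- 1#) ^ k) x (suc (2 ℕ.* k))
  sinTerm≡ x k = ≡.cong (scaledPower ((- 1#) ^ k) x) (ℕₚ.+-comm (2 ℕ.* k) 1)

  imaginary*real : ∀ i x y → real i *ᶜ (imaginary x *ᶜ real y) ≈ᶜ imaginary (i * (x * y))
  imaginary*real i x y =
    solve 3 (λ i x y → i :* (:0 :* y :- x :* :0) :- :0 :* (:0 :* :0 :+ x :* y) := :0) refl i x y ,
    solve 3 (λ i x y → i :* (:0 :* :0 :+ x :* y) :+ :0 :* (:0 :* y :- x :* :0) := i :* (x :* y)) refl i x y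
    where :0 = con⁺ 0

  imaginary*imaginary : ∀ i x y → real i *ᶜ (imaginary x *ᶜ imaginary y) ≈ᶜ real (- (i * (x * y)))
  imaginary*imaginary i x y =
    solve 3 (λ i x y → i :* (:0 :* :0 :- x :* y) :- :0 :* (:0 :* y :+ x :* :0)
      := :- (i :* (x :* y))) refl i x y ,
    solve 3 (λ i x y → i :* (:0 :* y :+ x :* :0) :+ :0 :* (:0 :* :0 :- x :* y) := :0) refl i x y
    where :0 = con⁺ 0

  -- Each step multiplies by i x over the next integer, so real and imaginary terms alternate; the
  -- step back to a real term contributes the sign i² = -1.
  expTerm-even : ∀ x k → expTerm (imaginary x) (2 ℕ.* k) ≈ᶜ real (cosTerm x k)
  expTerm-odd  : ∀ x k → expTerm (imaginary x) (suc (2 ℕ.* k)) ≈ᶜ imaginary (sinTerm x k)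

  expTerm-even x zero    = sym (scaledPower-0 x) , refl
  expTerm-even x (suc k) = ≡.subst
    (λ n → expTerm (imaginary x) n ≈ᶜ real (scaledPower ((- 1#) ^ suc k) x n))
    (≡.sym (ℕₚ.*-suc 2 k))
    (ℂ.trans (ℂ.*-congˡ {1/1+ (suc (2 ℕ.* k))} (ℂ.*-congˡ {imaginary x} (expTerm-odd x k)))
    (ℂ.trans (imaginary*imaginary (1# ÷ suc (suc (2 ℕ.* k))) x (sinTerm x k))
      (trans (-‿cong (trans (*-congˡ (*-congˡ (reflexive (sinTerm≡ x k))))
        (scaledPower-suc ((- 1#) ^ k) x (suc (2 ℕ.* k)))))
        (scaledPower-neg ((- 1#) ^ k) x (suc (suc (2 ℕ.* k)))) , refl)))

  expTerm-odd x k =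
    ℂ.trans (ℂ.*-congˡ {1/1+ (2 ℕ.* k)} (ℂ.*-congˡ {imaginary x} (expTerm-even x k)))
    (ℂ.trans (imaginary*real (1# ÷ suc (2 ℕ.* k)) x (cosTerm x k))
      (refl , trans (scaledPower-suc ((- 1#) ^ k) x (2 ℕ.* k)) (reflexive (≡.sym (sinTerm≡ x k)))))

  partialSum-interleave : ∀ a b c → (∀ k → a (2 ℕ.* k) ≈ᶜ real (b k)) → (∀ k →
    a (suc (2 ℕ.* k)) ≈ᶜ imaginary (c k)) →
    ∀ n → partialSum a (2 ℕ.* n) ≈ᶜ (sum {n} (b ∘ toℕ) , sum {n} (c ∘ toℕ))
  partialSum-interleave a b c even odd zero    = ℂ.refl
  partialSum-interleave a b c even odd (suc n) = ≡.subst
    (λ m → partialSum a m ≈ᶜ (sum {suc n} (b ∘ toℕ) , sum {suc n} (c ∘ toℕ)))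
    (≡.sym (ℕₚ.*-suc 2 n))
    (ℂ.trans (ℂ.+-cong (even 0) (ℂ.+-cong (odd 0) (partialSum-interleave (a ∘ suc ∘ suc) (b ∘ suc) (c ∘ suc)
        (λ k → ≡.subst (λ m → a m ≈ᶜ real (b (suc k))) (ℕₚ.*-suc 2 k) (even (suc k)))
        (λ k → ≡.subst (λ m → a (suc m) ≈ᶜ imaginary (c (suc k))) (ℕₚ.*-suc 2 k) (odd (suc k))) n)))
      ( solve 2 (λ x y → x :+ (con⁺ 0 :+ y) := x :+ y) refl _ _
      , solve 2 (λ x y → con⁺ 0 :+ (x :+ y) := x :+ y) refl _ _))

-- The addition theorem for cosine and sine

module Trigonometry {c ℓ₁ ℓ₂} (ℝ : RealField c ℓ₁ ℓ₂) {cos sin : RealField.Carrier ℝ → RealField.Carrier ℝ}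
  (cos-series : Plane.IsCosine ℝ cos) (sin-series : Plane.IsSine ℝ sin) where

  open Plane ℝ
  open OrderedFieldProperties orderedField
  open ComplexNumbers commutativeRing
  open ComplexNorm orderedField
  open RealAnalysis ℝ
  open ComplexExponential ℝ
  open CauchyProduct complexRing using (partialSum; partialSum-cong)
  open ExponentialSeries complexRing 1/1+ 1/1+-inverse

  cis : Carrier → ℂ
  cis x = cos x , sin x

  private
    -- The even length 2n collects exactly n cosine terms and n sine terms.
    cisSum : Carrier → ℕ → ℂ
    cisSum x n = expSum (imaginary x) (2 ℕ.* n)

    n≤2n : ∀ n → n ℕ.≤ 2 ℕ.* n
    n≤2n n = ℕₚ.m≤m+n n (n ℕ.+ 0)

  cisSum⟶cis : ∀ x → cisSum x ⟶ cis x
  cisSum⟶cis x = ⟶-cong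
    (λ n → ℂ.sym (partialSum-interleave (expTerm (imaginary x)) (cosTerm x) (sinTerm x)
      (expTerm-even x) (expTerm-odd x) n))
    (small-+ (converges⇒small (cos-series x)) (converges⇒small (sin-series x)))
    where
    converges⇒small : ∀ {s l} → s ConvergesTo l → EventuallySmall (λ n → ∣ s n - l ∣)
    converges⇒small s⟶l δ 0<δ = let N , s< = s⟶l δ 0<δ in N , λ n N≤n → <⇒≤ (s< n N≤n)

  -- `cos` and `sin` are bare functions on a setoid; that they respect `_≈_` follows from uniqueness
  -- of the limits of their series.
  cis-cong : ∀ {x y} → x ≈ y → cis x ≈ᶜ cis y
  cis-cong {x} {y} x≈y = ⟶-unique (cisSum⟶cis x)
    (⟶-cong (λ n → partialSum-cong (expTerm-cong {imaginary y} {imaginary x} (refl , sym x≈y)) (2 ℕ.* n)) (cisSum⟶cis y))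

  cis-+ : ∀ x y → cis (x + y) ≈ᶜ cis x *ᶜ cis y
  cis-+ x y = ⟶-unique (cisSum⟶cis (x + y))
    (⟶-cong (λ n → partialSum-cong (expTerm-cong {imaginary x +ᶜ imaginary y} {imaginary (x + y)}
      (+-identityˡ 0# , refl)) (2 ℕ.* n))
      (⟶-replace {λ n → cisSum x n *ᶜ cisSum y n} (small-∘ n≤2n (expSum-* (imaginary x) (imaginary y)))
        (⟶-* (λ n → proj₂ (expSum-bounded (imaginary y)) (2 ℕ.* n)) (cisSum⟶cis x) (cisSum⟶cis y))))

  cis-neg : ∀ x → cis (- x) ≈ᶜ conj (cis x)
  cis-neg x = ⟶-unique (cisSum⟶cis (- x)) (⟶-cong conj-cisSum (⟶-conj (cisSum⟶cis x)))
    where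
    conj-cisSum : ∀ n → conj (cisSum x n) ≈ᶜ cisSum (- x) n
    conj-cisSum n = ℂ.trans (partialSum-conj (expTerm (imaginary x)) (2 ℕ.* n))
      (partialSum-cong (expTerm-conj (imaginary x)) (2 ℕ.* n))

  cis-0 : cis 0# ≈ᶜ 1ᶜ
  -- The empty sum is 0, so the partial sums equal 1 only from index 1 on.
  cis-0 = ⟶-unique (cisSum⟶cis 0#) λ δ 0<δ → 1 , λ where
    (suc n) _ → ≤-trans (≤-reflexive (∥∥-cong (ℂ.trans (ℂ.+-congʳ (expSum-0 (n ℕ.+ suc (n ℕ.+ 0))))
      (ℂ.-‿inverseʳ 1ᶜ))))
      (≤-trans (∥real∥≤ ≤-refl) (<⇒≤ 0<δ))

-- The primitive cube root of unity

module ThirdTurn {c ℓ₁ ℓ₂} (ℝ : RealField c ℓ₁ ℓ₂) {cos sin : RealField.Carrier ℝ → RealField.Carrier ℝ}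
  (cos-series : Plane.IsCosine ℝ cos) (sin-series : Plane.IsSine ℝ sin) where

  open Plane ℝ
  open OrderedFieldProperties orderedField
  open ComplexNumbers commutativeRing
  open RealAnalysis ℝ
  open Trigonometry ℝ cos-series sin-series

  -- The conjugate is `cis (- x)`, so this is the addition theorem for x and -x. Its real part is
  -- the Pythagorean identity.
  cis-*-conj : ∀ x → cis x *ᶜ conj (cis x) ≈ᶜ 1ᶜ
  cis-*-conj x = ℂ.trans (ℂ.*-congˡ {cis x} (ℂ.sym (cis-neg x)))
    (ℂ.trans (ℂ.sym (cis-+ x (- x))) (ℂ.trans (cis-cong (-‿inverseʳ x)) cis-0))

  cos²+sin²≈1 : ∀ x → cos x * cos x + sin x * sin x ≈ 1#
  cos²+sin²≈1 x = trans
    (solve 2 (λ c s → c :* c :+ s :* s := c :* c :- s :* (:- s)) refl (cos x) (sin x)) (proj₁ (cis-*-conj x))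

  -- Squared moduli multiply. That of `z` is nonzero because of its imaginary part, so that of `w`
  -- vanishes, and with it both coordinates.
  *ᶜ-cancel-≈0 : ∀ {z w} → ¬ (proj₂ z ≈ 0#) → z *ᶜ w ≈ᶜ 0ᶜ → w ≈ᶜ 0ᶜ
  *ᶜ-cancel-≈0 {a , b} {c , d} b≉0 (p , q) =
    sum-of-squares≈0⇒≈0 ∥w∥²≈0 , sum-of-squares≈0⇒≈0 (trans (+-comm _ _) ∥w∥²≈0)
    where
    ∥w∥²≈0 : c * c + d * d ≈ 0#
    ∥w∥²≈0 = *-cancel-≈0 {a * a + b * b} (λ r → b≉0 (sum-of-squares≈0⇒≈0 (trans (+-comm _ _) r)))
      (trans (solve 4 (λ a b c d → (a :* a :+ b :* b) :* (c :* c :+ d :* d)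
          := (a :* c :- b :* d) :* (a :* c :- b :* d) :+ (a :* d :+ b :* c) :* (a :* d :+ b :* c)) refl a b c d)
        (trans (+-cong (*-cong p p) (*-cong q q)) (trans (+-cong (zeroˡ 0#) (zeroˡ 0#)) (+-identityˡ 0#))))

  module _ {π : Carrier} (isPi : IsPi sin π) where

    private
      0<π : 0# < π
      0<π = proj₁ isPi

    2π/3 4π/3 : Carrier
    2π/3 = fromℕ 2 * π ÷ 3
    4π/3 = fromℕ 4 * π ÷ 3

    ω : ℂ
    ω = cis 2π/3

    -- As sin π = 0, `cis π` is its own conjugate, so its square is its squared modulus.
    cis-π² : cis π *ᶜ cis π ≈ᶜ 1ᶜ
    cis-π² = ℂ.trans (ℂ.*-congˡ {cis π} (refl , trans sinπ≈0 (sym (trans (-‿cong sinπ≈0) -0≈0)))) (cis-*-conj π)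
      where
      -0≈0 : - 0# ≈ 0#
      -0≈0 = solve 0 (:- con⁺ 0 := con⁺ 0) refl
      sinπ≈0 : sin π ≈ 0#
      sinπ≈0 = proj₁ (proj₂ isPi)

    private
      3*÷3 : ∀ x → fromℕ 3 * (x ÷ 3) ≈ x
      3*÷3 x = trans (*-comm _ _) (÷-*-cancel x 3)

      third-< : ∀ {x y} → 0# < y → fromℕ 3 * x ≈ fromℕ 2 * y → x < y
      third-< {x} {y} 0<y p = 0<-⇒< (fromℕ-*-pos⁻¹ 3 (<-respʳ-≈
        (trans (solve 1 (λ y → y := con⁺ 3 :* y :- con⁺ 2 :* y) refl y)
          (trans (+-congˡ (-‿cong (sym p))) (solve 2 (λ x y → con⁺ 3 :* y :- con⁺ 3 :* x
            := con⁺ 3 :* (y :- x)) refl x y))) 0<y))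

      thrice-third : ∀ {x y} → fromℕ 3 * x ≈ fromℕ 2 * y → x + x + x ≈ y + y
      thrice-third {x} {y} p = trans (solve 1 (λ x → x :+ x :+ x := con⁺ 3 :* x) refl x)
        (trans p (solve 1 (λ y → con⁺ 2 :* y := y :+ y) refl y))

      twice-third : ∀ {x y z} → fromℕ 3 * x ≈ fromℕ 2 * z → fromℕ 3 * y ≈ fromℕ 4 * z → y ≈ x + x
      twice-third {x} {y} {z} p q = fromℕ-*-cancelˡ 3 (trans q (trans
        (solve 1 (λ z → con⁺ 4 :* z := con⁺ 2 :* z :+ con⁺ 2 :* z) refl z)
        (trans (sym (+-cong p p)) (sym (distribˡ (fromℕ 3) x x)))))

    sin-2π/3≉0 : ¬ (sin 2π/3 ≈ 0#)
    sin-2π/3≉0 sin≈0 = proj₂ (proj₂ isPi) 2π/3 (÷-pos 3 (*-pos (0<fromℕ 2) 0<π)) sin≈0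
      (third-< 0<π (3*÷3 (fromℕ 2 * π)))

    cis-4π/3 : cis 4π/3 ≈ᶜ ω *ᶜ ω
    cis-4π/3 = ℂ.trans (cis-cong (twice-third (3*÷3 (fromℕ 2 * π)) (3*÷3 (fromℕ 4 * π)))) (cis-+ 2π/3 2π/3)

    ω³≈1 : ω *ᶜ ω *ᶜ ω ≈ᶜ 1ᶜ
    ω³≈1 = ℂ.trans (ℂ.*-congʳ {ω} (ℂ.sym (cis-+ 2π/3 2π/3))) (ℂ.trans (ℂ.sym (cis-+ (2π/3 + 2π/3) 2π/3))
      (ℂ.trans (cis-cong (thrice-third (3*÷3 (fromℕ 2 * π)))) (ℂ.trans (cis-+ π π) cis-π²)))

    1+ω+ω²≈0 : 1ᶜ +ᶜ ω +ᶜ ω *ᶜ ω ≈ᶜ 0ᶜ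
    -- The factor ω - 1 of ω³ - 1 can be cancelled because its imaginary part is sin (2π/3).
    1+ω+ω²≈0 = *ᶜ-cancel-≈0 {ω +ᶜ -ᶜ 1ᶜ}
      (λ p → sin-2π/3≉0 (trans (solve 1 (λ s → s := s :- con⁺ 0) refl (sin 2π/3)) p))
      (ℂ.trans (solveᶜ 1 (λ w → (w :-ᶜ :1) :*ᶜ (:1 :+ᶜ w :+ᶜ w :*ᶜ w)
          :=ᶜ w :*ᶜ w :*ᶜ w :-ᶜ :1) ℂ.refl ω)
        (ℂ.trans (ℂ.+-congʳ ω³≈1) (ℂ.-‿inverseʳ 1ᶜ)))
      where :1 = conᶜ (+ 1)

-- Near and far abscissae, and the contradiction modulo 3

module StripCovering {c ℓ₁ ℓ₂} (ℝ : RealField c ℓ₁ ℓ₂) where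

  open Plane ℝ
  open OrderedFieldProperties orderedField
  open RealAnalysis ℝ using (fromℕ-*-pos⁻¹)
  open ℤ-Solver.+-*-Solver using () renaming
    ( solve to solveℤ; _:=_ to _:=ℤ_; _:+_ to _:+ℤ_; _:*_ to _:*ℤ_; _:-_ to _:-ℤ_; con to conℤ
    ; Polynomial to Polynomialℤ )

  -- Linear arithmetic in the presence of equations: `e` is a combination of known equations, while
  -- the last hypothesis is a plain ring identity for the solver.
  <-by-mod : ∀ {x y p e} → 0# < p → e ≈ 0# → p ≈ y - x + e → x < y
  <-by-mod 0<p e≈0 eq = <-by 0<p (trans eq (trans (+-congˡ e≈0) (+-identityʳ _)))

  -- Distances are measured in units of 1/48, so that ε = 1/3 − 1/48 is 15 units.
  -- Near and Far overlap in one unit, which makes the choice between them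
  -- effective although the order is not decidable.
  offset : Carrier → ℤ → Carrier
  offset t n = fromℕ 48 * (t - fromℤ n)

  Near Far : Carrier → ℤ → Set ℓ₂
  Near t n = - fromℕ 15 < offset t n × offset t n < fromℕ 15
  Far  t n = fromℕ 14 < offset t n × offset t n < fromℕ 34

  offset-suc : ∀ t n → offset t (n ℤ.+ + 1) ≈ offset t n - fromℕ 48
  offset-suc t n = trans (*-congˡ (+-congˡ (-‿cong (fromℤ-homo-+ n (+ 1)))))
    (solve 2 (λ t n → con⁺ 48 :* (t :- (n :+ (con⁺ 1 :+ con⁺ 0)))
      := con⁺ 48 :* (t :- n) :- con⁺ 48) refl t (fromℤ n))

  14<15 : fromℕ 14 < fromℕ 15
  14<15 = <-by 0<1 (solve 0 (con⁺ 1 := con⁺ 15 :- con⁺ 14) refl)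

  33<34 : fromℕ 33 < fromℕ 34
  33<34 = <-by 0<1 (solve 0 (con⁺ 1 := con⁺ 34 :- con⁺ 33) refl)

  -- A search to the right. An offset below 34 = 48 - 14 is settled at `n` by comparison with 14 and
  -- 15; one above 33 exceeds -15 relative to n + 1, so the search goes on there. The bound `k`
  -- decreases, and at 0 it contradicts a positive offset.
  near-or-far-from : ∀ t k n → - fromℕ 15 < offset t n → t < fromℤ n + fromℕ k →
    (∃[ m ] Near t m) ⊎ (∃[ m ] Far t m)
  near-or-far-from t k n -15<z t<n+k =
    [ advance k t<n+k , (λ z<34 → [ far z<34 , near ]′ (<-cotrans 14<15 (offset t n))) ]′
      (<-cotrans 33<34 (offset t n))
    where
    far : offset t n < fromℕ 34 → fromℕ 14 < offset t n → (∃[ m ] Near t m) ⊎ (∃[ m ] Far t m)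
    far z<34 14<z = inj₂ (n , 14<z , z<34)

    near : offset t n < fromℕ 15 → (∃[ m ] Near t m) ⊎ (∃[ m ] Far t m)
    near z<15 = inj₁ (n , -15<z , z<15)

    advance : ∀ k → t < fromℤ n + fromℕ k → fromℕ 33 < offset t n → (∃[ m ] Near t m) ⊎ (∃[ m ] Far t m)
    advance zero t<n+0 33<z = ⊥-elim (<-irrefl refl
      (<-by (+-pos (<⇒0<- 33<z) (+-pos (0<fromℕ 33) (fromℕ-*-pos 47 (<⇒0<- t<n+0))))
        (solve 2 (λ t n → con⁺ 48 :* (t :- n) :- con⁺ 33 :+ (con⁺ 33 :+ con⁺ 48 :* (n :+ con⁺ 0 :- t))
          := con⁺ 0 :- con⁺ 0) refl t (fromℤ n))))
    advance (suc k) t<n+k 33<z = near-or-far-from t k (n ℤ.+ + 1)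
      (<-respʳ-≈ (sym (offset-suc t n)) (<-by (<⇒0<- 33<z)
        (solve 1 (λ z → z :- con⁺ 33 := z :- con⁺ 48 :- :- con⁺ 15) refl (offset t n))))
      (<-respʳ-≈ (trans (solve 2 (λ n k → n :+ (con⁺ 1 :+ k)
        := n :+ (con⁺ 1 :+ con⁺ 0) :+ k) refl (fromℤ n) (fromℕ k))
        (+-congʳ (sym (fromℤ-homo-+ n (+ 1))))) t<n+k)

  near-or-far : ∀ t → (∃[ n ] Near t n) ⊎ (∃[ n ] Far t n)
  near-or-far t =
    let a , t<a = archimedean t
        b , -t<b = archimedean (- t)
    -- Since -b < t < a, a search starting at -b has at most b + a steps to go.
    in near-or-far-from t (b ℕ.+ a) (ℤ.- + b)
      (<-by (+-pos (0<fromℕ 15) (fromℕ-*-pos 47 (<⇒0<- -t<b)))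
        (trans (solve 2 (λ t b → con⁺ 15 :+ con⁺ 48 :* (b :- :- t)
          := con⁺ 48 :* (t :- :- b) :- :- con⁺ 15) refl t (fromℕ b))
          (+-congʳ (*-congˡ (+-congˡ (-‿cong (sym (fromℤ-homo-neg (+ b)))))))))
      (<-respʳ-≈ (trans (solve 2 (λ a b → a := :- b :+ (b :+ a)) refl (fromℕ a) (fromℕ b))
        (+-cong (sym (fromℤ-homo-neg (+ b))) (sym (fromℤ-homo-+ (+ b) (+ a))))) t<a)

  -- |t − k/3| < 1/12, in the same units.
  Close : Carrier → ℤ → Set ℓ₂
  Close t k = - fromℕ 4 < fromℕ 48 * t - fromℕ 16 * fromℤ k × fromℕ 48 * t - fromℕ 16 * fromℤ k < fromℕ 4

  record CloseToThirds (t₀ t₁ t₂ : Carrier) : Set ℓ₂ where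
    field
      s m₀ m₁ m₂ : ℤ
      s≡±1   : s ≡ + 1 ⊎ s ≡ -[1+ 0 ]
      Σm+s≡0 : m₀ ℤ.+ m₁ ℤ.+ m₂ ℤ.+ s ≡ + 0
      close₀ : Close t₀ (+ 3 ℤ.* m₀ ℤ.+ s)
      close₁ : Close t₁ (+ 3 ℤ.* m₁ ℤ.+ s)
      close₂ : Close t₂ (+ 3 ℤ.* m₂ ℤ.+ s)

  fromℤ-3m+s : ∀ m s → fromℤ (+ 3 ℤ.* m ℤ.+ s) ≈ fromℕ 3 * fromℤ m + fromℤ s
  fromℤ-3m+s m s = trans (fromℤ-homo-+ (+ 3 ℤ.* m) s) (+-congʳ (fromℤ-homo-* (+ 3) m))

  close : ∀ {t m s} → - fromℕ 4 < fromℕ 48 * t - fromℕ 16 * (fromℕ 3 * fromℤ m + fromℤ s) →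
    fromℕ 48 * t - fromℕ 16 * (fromℕ 3 * fromℤ m + fromℤ s) < fromℕ 4 → Close t (+ 3 ℤ.* m ℤ.+ s)
  close {t} {m} {s} p q = <-respʳ-≈ eq p , <-respˡ-≈ eq q
    where
    eq = +-congˡ (-‿cong (*-congˡ (sym (fromℤ-3m+s m s))))

  private
    Σ≈ : ∀ {x₀ x₁ x₂ y} → x₀ + x₁ + x₂ ≈ y → fromℕ 48 * (x₀ + x₁ + x₂ - y) ≈ 0#
    Σ≈ {x₀} {x₁} {x₂} {y} p = trans (*-congˡ (trans (+-congʳ p) (-‿inverseʳ y))) (zeroʳ (fromℕ 48))

    Σ≈-Σ≈ : ∀ {x y} → x ≈ 0# → y ≈ 0# → x - y ≈ 0#
    Σ≈-Σ≈ p q = trans (+-cong p (-‿cong q)) (-‿inverseʳ 0#)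

    rotate : ∀ {x y z w} → x + y + z ≈ w → y + z + x ≈ w
    rotate {x} {y} {z} p = trans (solve 3 (λ x y z → y :+ z :+ x := x :+ y :+ z) refl x y z) p

    fromℤ-Σ : ∀ i j k {l} → i ℤ.+ j ℤ.+ k ≡ l → fromℤ i + fromℤ j + fromℤ k ≈ fromℤ l
    fromℤ-Σ i j k eq = trans (sym (trans (fromℤ-homo-+ (i ℤ.+ j) k)
      (+-congʳ (fromℤ-homo-+ i j)))) (reflexive (≡.cong fromℤ eq))

  -- The third n₀ + 1/3 has offset 16. The lower bound 14 on the offset of `t₀` is 16 - 2; since the
  -- three offsets sum to 48 and the other two exceed 14, it is also below 48 - 28 = 16 + 4.
  far-Σ≡-1⇒close : ∀ {t₀ t₁ t₂} n₀ n₁ n₂ → t₀ + t₁ + t₂ ≈ 0# → fromℤ n₀ + fromℤ n₁ + fromℤ n₂ ≈ fromℤ -[1+ 0 ] →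
    Far t₀ n₀ → Far t₁ n₁ → Far t₂ n₂ → Close t₀ (+ 3 ℤ.* n₀ ℤ.+ + 1)
  far-Σ≡-1⇒close {t₀} {t₁} {t₂} n₀ n₁ n₂ Σt Σn (l₀ , _) (l₁ , _) (l₂ , _) = close {m = n₀} {+ 1}
    (<-by (+-pos (<⇒0<- l₀) (0<fromℕ 2))
      (solve 2 (λ t n → con⁺ 48 :* (t :- n) :- con⁺ 14 :+ con⁺ 2
        := con⁺ 48 :* t :- con⁺ 16 :* (con⁺ 3 :* n :+ (con⁺ 1 :+ con⁺ 0)) :- :- con⁺ 4) refl t₀ (fromℤ n₀)))
    (<-by-mod (+-pos (<⇒0<- l₁) (<⇒0<- l₂)) (Σ≈-Σ≈ (Σ≈ Σt) (Σ≈ Σn))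
      (solve 6 (λ t₀ t₁ t₂ n₀ n₁ n₂ → con⁺ 48 :* (t₁ :- n₁) :- con⁺ 14 :+ (con⁺ 48 :* (t₂ :- n₂) :- con⁺ 14)
        := con⁺ 4 :- (con⁺ 48 :* t₀ :- con⁺ 16 :* (con⁺ 3 :* n₀ :+ (con⁺ 1 :+ con⁺ 0)))
           :+ (con⁺ 48 :* (t₀ :+ t₁ :+ t₂ :- con⁺ 0) :- con⁺ 48 :* (n₀ :+ n₁ :+ n₂ :- con -[1+ 0 ])))
        refl t₀ t₁ t₂ (fromℤ n₀) (fromℤ n₁) (fromℤ n₂)))

  -- The mirror image: the third n₀ + 2/3, written (n₀ + 1) - 1/3, has offset 32, the offsets sum to
  -- 96, and the bounds are 34 = 32 + 2 and 96 - 68 = 32 - 4.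
  far-Σ≡-2⇒close : ∀ {t₀ t₁ t₂} n₀ n₁ n₂ → t₀ + t₁ + t₂ ≈ 0# → fromℤ n₀ + fromℤ n₁ + fromℤ n₂ ≈ fromℤ -[1+ 1 ] →
    Far t₀ n₀ → Far t₁ n₁ → Far t₂ n₂ → Close t₀ (+ 3 ℤ.* (n₀ ℤ.+ + 1) ℤ.+ -[1+ 0 ])
  far-Σ≡-2⇒close {t₀} {t₁} {t₂} n₀ n₁ n₂ Σt Σn (_ , u₀) (_ , u₁) (_ , u₂) = close {m = n₀ ℤ.+ + 1} { -[1+ 0 ]}
    (<-respʳ-≈ (+-congˡ (-‿cong (*-congˡ (+-congʳ (*-congˡ (sym (fromℤ-homo-+ n₀ (+ 1))))))))
      (<-by-mod (+-pos (<⇒0<- u₁) (<⇒0<- u₂)) (Σ≈-Σ≈ (Σ≈ Σn) (Σ≈ Σt))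
        (solve 6 (λ t₀ t₁ t₂ n₀ n₁ n₂ → con⁺ 34 :- con⁺ 48 :* (t₁ :- n₁) :+ (con⁺ 34 :- con⁺ 48 :* (t₂ :- n₂))
          := con⁺ 48 :* t₀ :- con⁺ 16 :* (con⁺ 3 :* (n₀ :+ (con⁺ 1 :+ con⁺ 0)) :+ con -[1+ 0 ]) :- :- con⁺ 4
             :+ (con⁺ 48 :* (n₀ :+ n₁ :+ n₂ :- con -[1+ 1 ]) :- con⁺ 48 :* (t₀ :+ t₁ :+ t₂ :- con⁺ 0)))
          refl t₀ t₁ t₂ (fromℤ n₀) (fromℤ n₁) (fromℤ n₂))))
    (<-respˡ-≈ (+-congˡ (-‿cong (*-congˡ (+-congʳ (*-congˡ (sym (fromℤ-homo-+ n₀ (+ 1))))))))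
      (<-by (+-pos (<⇒0<- u₀) (0<fromℕ 2))
        (solve 2 (λ t n → con⁺ 34 :- con⁺ 48 :* (t :- n) :+ con⁺ 2
          := con⁺ 4 :- (con⁺ 48 :* t :- con⁺ 16 :* (con⁺ 3 :* (n :+ (con⁺ 1 :+ con⁺ 0)) :+ con -[1+ 0 ])))
          refl t₀ (fromℤ n₀))))

  -3<i<0⇒i≡-1⊎i≡-2 : ∀ {i} → -[1+ 2 ] ℤ.< i → i ℤ.< + 0 → i ≡ -[1+ 0 ] ⊎ i ≡ -[1+ 1 ]
  -3<i<0⇒i≡-1⊎i≡-2 (ℤ.-<- {n = 0} _)            ℤ.-<+ = inj₁ ≡.refl
  -3<i<0⇒i≡-1⊎i≡-2 (ℤ.-<- {n = 1} _)            ℤ.-<+ = inj₂ ≡.refl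
  -3<i<0⇒i≡-1⊎i≡-2 (ℤ.-<- {n = suc (suc _)} (s≤s (s≤s ()))) ℤ.-<+

  -1<i<1⇒i≡0 : ∀ {i} → -[1+ 0 ] ℤ.< i → i ℤ.< + 1 → i ≡ + 0
  -1<i<1⇒i≡0 ℤ.-<+ (ℤ.+<+ (s≤s z≤n)) = ≡.refl

  -- With N = n₀ + n₁ + n₂, the offsets sum to -48 N. Each lies between 14 and 34, so the sum lies
  -- between 42 and 102, which is inside (0, 144) with slack 42 on both sides; hence N is -1 or -2.
  far⇒closeToThirds : ∀ {t₀ t₁ t₂ n₀ n₁ n₂} → t₀ + t₁ + t₂ ≈ 0# →
    Far t₀ n₀ → Far t₁ n₁ → Far t₂ n₂ → CloseToThirds t₀ t₁ t₂
  far⇒closeToThirds {t₀} {t₁} {t₂} {n₀} {n₁} {n₂} Σt f₀@(l₀ , u₀) f₁@(l₁ , u₁) f₂@(l₂ , u₂)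
    with -3<i<0⇒i≡-1⊎i≡-2 (fromℤ-reflects-< (<-respʳ-≈ Σn≈N -3<N)) (fromℤ-reflects-< (<-respˡ-≈ Σn≈N N<0))
    where
    Σn≈N = fromℤ-Σ n₀ n₁ n₂ ≡.refl
    -3<N : fromℤ -[1+ 2 ] < fromℤ n₀ + fromℤ n₁ + fromℤ n₂
    -3<N = 0<-⇒< (fromℕ-*-pos⁻¹ 48 (<-by-mod
      (+-pos (+-pos (+-pos (<⇒0<- u₀) (<⇒0<- u₁)) (<⇒0<- u₂)) (0<fromℕ 42)) (trans (-‿cong (Σ≈ Σt))
        (solve 0 (:- con⁺ 0 := con⁺ 0) refl))
      (solve 6 (λ t₀ t₁ t₂ n₀ n₁ n₂ → con⁺ 34 :- con⁺ 48 :* (t₀ :- n₀) :+ (con⁺ 34 :- con⁺ 48 :* (t₁ :- n₁))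
          :+ (con⁺ 34 :- con⁺ 48 :* (t₂ :- n₂)) :+ con⁺ 42
        := con⁺ 48 :* (n₀ :+ n₁ :+ n₂ :- con -[1+ 2 ]) :- con⁺ 0 :+ :- (con⁺ 48 :* (t₀ :+ t₁ :+ t₂ :- con⁺ 0)))
        refl t₀ t₁ t₂ (fromℤ n₀) (fromℤ n₁) (fromℤ n₂))))
    N<0 : fromℤ n₀ + fromℤ n₁ + fromℤ n₂ < fromℤ (+ 0)
    N<0 = 0<-⇒< (fromℕ-*-pos⁻¹ 48 (<-by-mod
      (+-pos (+-pos (+-pos (<⇒0<- l₀) (<⇒0<- l₁)) (<⇒0<- l₂)) (0<fromℕ 42)) (Σ≈ Σt)
      (solve 6 (λ t₀ t₁ t₂ n₀ n₁ n₂ → con⁺ 48 :* (t₀ :- n₀) :- con⁺ 14 :+ (con⁺ 48 :* (t₁ :- n₁) :- con⁺ 14)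
          :+ (con⁺ 48 :* (t₂ :- n₂) :- con⁺ 14) :+ con⁺ 42
        := con⁺ 48 :* (con⁺ 0 :- (n₀ :+ n₁ :+ n₂)) :- con⁺ 0 :+ con⁺ 48 :* (t₀ :+ t₁ :+ t₂ :- con⁺ 0))
        refl t₀ t₁ t₂ (fromℤ n₀) (fromℤ n₁) (fromℤ n₂))))
  ... | inj₁ N≡-1 = record
    { s = + 1 ; m₀ = n₀ ; m₁ = n₁ ; m₂ = n₂
    ; s≡±1 = inj₁ ≡.refl
    ; Σm+s≡0 = ≡.cong (ℤ._+ + 1) N≡-1
    ; close₀ = far-Σ≡-1⇒close n₀ n₁ n₂ Σt Σn f₀ f₁ f₂
    ; close₁ = far-Σ≡-1⇒close n₁ n₂ n₀ (rotate Σt) (rotate Σn) f₁ f₂ f₀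
    ; close₂ = far-Σ≡-1⇒close n₂ n₀ n₁ (rotate (rotate Σt)) (rotate (rotate Σn)) f₂ f₀ f₁
    }
    where Σn = fromℤ-Σ n₀ n₁ n₂ N≡-1
  ... | inj₂ N≡-2 = record
    { s = -[1+ 0 ] ; m₀ = n₀ ℤ.+ + 1 ; m₁ = n₁ ℤ.+ + 1 ; m₂ = n₂ ℤ.+ + 1
    ; s≡±1 = inj₂ ≡.refl
    ; Σm+s≡0 = ≡.trans
        (solveℤ 3 (λ i j k → (i :+ℤ :1) :+ℤ (j :+ℤ :1) :+ℤ (k :+ℤ :1) :+ℤ conℤ -[1+ 0 ]
          :=ℤ i :+ℤ j :+ℤ k :+ℤ conℤ (+ 2))
          ≡.refl n₀ n₁ n₂)
        (≡.cong (ℤ._+ + 2) N≡-2)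
    ; close₀ = far-Σ≡-2⇒close n₀ n₁ n₂ Σt Σn f₀ f₁ f₂
    ; close₁ = far-Σ≡-2⇒close n₁ n₂ n₀ (rotate Σt) (rotate Σn) f₁ f₂ f₀
    ; close₂ = far-Σ≡-2⇒close n₂ n₀ n₁ (rotate (rotate Σt)) (rotate (rotate Σn)) f₂ f₀ f₁
    }
    where
    Σn = fromℤ-Σ n₀ n₁ n₂ N≡-2
    :1 : ∀ {n} → Polynomialℤ n
    :1 = conℤ (+ 1)

  private
    +-pos-nonneg : ∀ {x y} → 0# < x → 0# ≤ y → 0# < x + y
    +-pos-nonneg {x} {y} 0<x 0≤y = <-≤-trans 0<x (≤-by 0≤y (solve 2 (λ x y → y := x :+ y :- x) refl x y))

    combine : ∀ {x y z r} → 0# < x → 0# < y → 0# < z → 0# ≤ r →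
      0# < fromℕ 3 * x + fromℕ 3 * y + fromℕ 2 * z + fromℕ 16 * r
    combine 0<x 0<y 0<z 0≤r = +-pos-nonneg
      (+-pos (+-pos (fromℕ-*-pos 2 0<x) (fromℕ-*-pos 2 0<y)) (fromℕ-*-pos 1 0<z)) (*-nonneg (0≤fromℕ 16) 0≤r)

  -- With S = ±1 and Y the bounded quantity, 9 (v + w) − 6 u = 0 puts S + 3 Y into
  -- (−2, 2).
  thirds-differ : ∀ {u v w M S V W} → fromℕ 3 * (v + w) ≈ fromℕ 2 * u → - 1# ≤ S → S ≤ 1# →
    - fromℕ 4 < fromℕ 48 * u - fromℕ 16 * (fromℕ 3 * M + S) × fromℕ 48 * u - fromℕ 16 * (fromℕ 3 * M + S) < fromℕ 4 →
    - fromℕ 4 < fromℕ 48 * v - fromℕ 16 * V × fromℕ 48 * v - fromℕ 16 * V < fromℕ 4 →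
    - fromℕ 4 < fromℕ 48 * w - fromℕ 16 * W × fromℕ 48 * w - fromℕ 16 * W < fromℕ 4 →
    - 1# < V + W - fromℕ 2 * M - S × V + W - fromℕ 2 * M - S < 1#
  thirds-differ {u} {v} {w} {M} {S} {V} {W} eq -1≤S S≤1 (lᵤ , uᵤ) (lᵥ , uᵥ) (lw , uw) =
    -- The weights 3, 3 and 2 turn the bounds of 4 units into 32, and the bound on `S` adds 16:
    -- together exactly the 48 units of one integer step.
    0<-⇒< (fromℕ-*-pos⁻¹ 48 (<-by-mod (combine (<⇒0<- uᵥ) (<⇒0<- uw) (<⇒0<- lᵤ) (≤⇒0≤- S≤1)) (-e≈0 (- fromℕ 48))
      (solve 7 (λ u v w M S V W →
          con⁺ 3 :* (con⁺ 4 :- (con⁺ 48 :* v :- con⁺ 16 :* V))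
          :+ con⁺ 3 :* (con⁺ 4 :- (con⁺ 48 :* w :- con⁺ 16 :* W))
          :+ con⁺ 2 :* (con⁺ 48 :* u :- con⁺ 16 :* (con⁺ 3 :* M :+ S) :- :- con⁺ 4) :+ con⁺ 16 :* (con⁺ 1 :- S)
        := con⁺ 48 :* (V :+ W :- con⁺ 2 :* M :- S :- :- con⁺ 1) :- con⁺ 0
          :+ :- con⁺ 48 :* (con⁺ 3 :* (v :+ w) :- con⁺ 2 :* u)) refl u v w M S V W))) ,
    0<-⇒< (fromℕ-*-pos⁻¹ 48 (<-by-mod (combine (<⇒0<- lᵥ) (<⇒0<- lw) (<⇒0<- uᵤ) (≤⇒0≤- -1≤S)) (-e≈0 (fromℕ 48))
      (solve 7 (λ u v w M S V W →
          con⁺ 3 :* (con⁺ 48 :* v :- con⁺ 16 :* V :- :- con⁺ 4)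
          :+ con⁺ 3 :* (con⁺ 48 :* w :- con⁺ 16 :* W :- :- con⁺ 4)
          :+ con⁺ 2 :* (con⁺ 4 :- (con⁺ 48 :* u :- con⁺ 16 :* (con⁺ 3 :* M :+ S))) 
          :+ con⁺ 16 :* (S :- :- con⁺ 1)
        := con⁺ 48 :* (con⁺ 1 :- (V :+ W :- con⁺ 2 :* M :- S)) :- con⁺ 0
          :+ con⁺ 48 :* (con⁺ 3 :* (v :+ w) :- con⁺ 2 :* u)) refl u v w M S V W)))
    where
    -e≈0 : ∀ x → x * (fromℕ 3 * (v + w) - fromℕ 2 * u) ≈ 0#
    -e≈0 x = trans (*-congˡ (trans (+-congʳ eq) (-‿inverseʳ _))) (zeroʳ x)

  -- Inserting the thirds kᵥ/3, k_w/3 and m + s/3 into 9 (v + w) - 6 u gives `s` plus three times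
  -- this integer.
  discrepancy : ℤ → ℤ → ℤ → ℤ → ℤ
  discrepancy m s kᵥ k_w = kᵥ ℤ.+ k_w ℤ.- + 2 ℤ.* m ℤ.- s

  discrepancy≡0 : ∀ {u v w} m s kᵥ k_w → s ≡ + 1 ⊎ s ≡ -[1+ 0 ] → fromℕ 3 * (v + w) ≈ fromℕ 2 * u →
    Close u (+ 3 ℤ.* m ℤ.+ s) → Close v kᵥ → Close w k_w → discrepancy m s kᵥ k_w ≡ + 0
  discrepancy≡0 m s kᵥ k_w s≡±1 3v+3w≈2u closeᵤ closeᵥ close_w =
    let -1<Y , Y<1 = thirds-differ {M = fromℤ m} {fromℤ s} 3v+3w≈2u
          (≤-trans (≤-reflexive (-‿cong (sym (+-identityʳ 1#)))) (fromℤ-mono-≤ (-1≤s s≡±1)))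
          (≤-trans (fromℤ-mono-≤ (s≤1 s≡±1)) (≤-reflexive (+-identityʳ 1#)))
          (<-respʳ-≈ 3m+s≈ (proj₁ closeᵤ) , <-respˡ-≈ 3m+s≈ (proj₂ closeᵤ)) closeᵥ close_w
    in -1<i<1⇒i≡0 (fromℤ-reflects-< (<-respʳ-≈ Y≈ (<-respˡ-≈ (-‿cong (sym (+-identityʳ 1#))) -1<Y)))
         (fromℤ-reflects-< (<-respˡ-≈ Y≈ (<-respʳ-≈ (sym (+-identityʳ 1#)) Y<1)))
    where
    3m+s≈ = +-congˡ (-‿cong (*-congˡ (fromℤ-3m+s m s)))
    -1≤s : s ≡ + 1 ⊎ s ≡ -[1+ 0 ] → -[1+ 0 ] ℤ.≤ s
    -1≤s (inj₁ ≡.refl) = ℤ.-≤+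
    -1≤s (inj₂ ≡.refl) = ℤₚ.≤-refl
    s≤1 : s ≡ + 1 ⊎ s ≡ -[1+ 0 ] → s ℤ.≤ + 1
    s≤1 (inj₁ ≡.refl) = ℤₚ.≤-refl
    s≤1 (inj₂ ≡.refl) = ℤ.-≤+
    Y≈ : fromℤ kᵥ + fromℤ k_w - fromℕ 2 * fromℤ m - fromℤ s ≈ fromℤ (discrepancy m s kᵥ k_w)
    Y≈ = sym (trans (fromℤ-homo-+ (kᵥ ℤ.+ k_w ℤ.- + 2 ℤ.* m) (ℤ.- s)) (+-cong
      (trans (fromℤ-homo-+ (kᵥ ℤ.+ k_w) (ℤ.- (+ 2 ℤ.* m)))
        (+-cong (fromℤ-homo-+ kᵥ k_w) (trans (fromℤ-homo-neg (+ 2 ℤ.* m)) (-‿cong (fromℤ-homo-* (+ 2) m)))))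
      (fromℤ-homo-neg s)))

  -- The discrepancies of the three coordinates vanish, yet they add up to −s
  -- for the sign s of the first triple.
  closeToThirds-incompatible : ∀ {u₀ u₁ u₂ v₀ v₁ v₂ w₀ w₁ w₂} →
    fromℕ 3 * (v₀ + w₀) ≈ fromℕ 2 * u₀ → fromℕ 3 * (v₁ + w₁) ≈ fromℕ 2 * u₁ →
      fromℕ 3 * (v₂ + w₂) ≈ fromℕ 2 * u₂ →
    CloseToThirds u₀ u₁ u₂ → CloseToThirds v₀ v₁ v₂ → ¬ CloseToThirds w₀ w₁ w₂
  closeToThirds-incompatible eq₀ eq₁ eq₂ cᵤ cᵥ cw = s≢0 U.s≡±1 s≡0
    where
    module U = CloseToThirds cᵤ
    module V = CloseToThirds cᵥ
    module W = CloseToThirds cw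

    third : ℤ → ℤ → ℤ
    third m s = + 3 ℤ.* m ℤ.+ s

    total : ℤ → ℤ → ℤ → ℤ → ℤ → ℤ → ℤ
    total a b c x y z = + 3 ℤ.* b ℤ.+ + 3 ℤ.* c ℤ.- + 2 ℤ.* a ℤ.- (x ℤ.+ y ℤ.+ z)

    s≡0 : U.s ≡ + 0
    s≡0 = ≡.trans
      -- The sign is a combination of six vanishing integers: the three sums Σm + s and the three
      -- discrepancies.
      (solveℤ 12 (λ s sᵥ sw m₀ m₁ m₂ a₀ a₁ a₂ b₀ b₁ b₂ → s :=ℤ
          :3 :*ℤ (a₀ :+ℤ a₁ :+ℤ a₂ :+ℤ sᵥ) :+ℤ :3 :*ℤ (b₀ :+ℤ b₁ :+ℤ b₂ :+ℤ sw)
          :-ℤ :2 :*ℤ (m₀ :+ℤ m₁ :+ℤ m₂ :+ℤ s)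
          :-ℤ (disc m₀ s (:3 :*ℤ a₀ :+ℤ sᵥ) (:3 :*ℤ b₀ :+ℤ sw)
               :+ℤ disc m₁ s (:3 :*ℤ a₁ :+ℤ sᵥ) (:3 :*ℤ b₁ :+ℤ sw)
               :+ℤ disc m₂ s (:3 :*ℤ a₂ :+ℤ sᵥ) (:3 :*ℤ b₂ :+ℤ sw)))
        ≡.refl U.s V.s W.s U.m₀ U.m₁ U.m₂ V.m₀ V.m₁ V.m₂ W.m₀ W.m₁ W.m₂)
      (totals U.Σm+s≡0 V.Σm+s≡0 W.Σm+s≡0
        (discrepancy≡0 U.m₀ U.s (third V.m₀ V.s) (third W.m₀ W.s) U.s≡±1 eq₀ U.close₀ V.close₀ W.close₀)
        (discrepancy≡0 U.m₁ U.s (third V.m₁ V.s) (third W.m₁ W.s) U.s≡±1 eq₁ U.close₁ V.close₁ W.close₁)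
        (discrepancy≡0 U.m₂ U.s (third V.m₂ V.s) (third W.m₂ W.s) U.s≡±1 eq₂ U.close₂ V.close₂ W.close₂))
      where
      :3 :2 : ∀ {n} → Polynomialℤ n
      :3 = conℤ (+ 3)
      :2 = conℤ (+ 2)
      disc : ∀ {n} → Polynomialℤ n → Polynomialℤ n → Polynomialℤ n → Polynomialℤ n → Polynomialℤ n
      disc m s v w = v :+ℤ w :-ℤ :2 :*ℤ m :-ℤ s
      totals : ∀ {a b c x y z} → a ≡ + 0 → b ≡ + 0 → c ≡ + 0 → x ≡ + 0 → y ≡ + 0 → z ≡ + 0 →
        total a b c x y z ≡ + 0
      totals ≡.refl ≡.refl ≡.refl ≡.refl ≡.refl ≡.refl = ≡.refl

    s≢0 : ∀ {s} → s ≡ + 1 ⊎ s ≡ -[1+ 0 ] → ¬ (s ≡ + 0)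
    s≢0 (inj₁ ≡.refl) ()
    s≢0 (inj₂ ≡.refl) ()

  near-or-closeToThirds : ∀ t₀ t₁ t₂ → t₀ + t₁ + t₂ ≈ 0# →
    ((∃[ n ] Near t₀ n) ⊎ (∃[ n ] Near t₁ n) ⊎ (∃[ n ] Near t₂ n)) ⊎ CloseToThirds t₀ t₁ t₂
  near-or-closeToThirds t₀ t₁ t₂ Σt = decide (near-or-far t₀) (near-or-far t₁) (near-or-far t₂)
    where
    decide : (∃[ n ] Near t₀ n) ⊎ (∃[ n ] Far t₀ n) → (∃[ n ] Near t₁ n) ⊎ (∃[ n ] Far t₁ n) →
      (∃[ n ] Near t₂ n) ⊎ (∃[ n ] Far t₂ n) →
      ((∃[ n ] Near t₀ n) ⊎ (∃[ n ] Near t₁ n) ⊎ (∃[ n ] Near t₂ n)) ⊎ CloseToThirds t₀ t₁ t₂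
    decide (inj₁ near) _ _ = inj₁ (inj₁ near)
    decide _ (inj₁ near) _ = inj₁ (inj₂ (inj₁ near))
    decide _ _ (inj₁ near) = inj₁ (inj₂ (inj₂ near))
    decide (inj₂ (n₀ , far₀)) (inj₂ (n₁ , far₁)) (inj₂ (n₂ , far₂)) =
      inj₂ (far⇒closeToThirds {n₀ = n₀} {n₁} {n₂} Σt far₀ far₁ far₂)

-- Near abscissae and the distance to the nearest integer

module NearestInteger {c ℓ₁ ℓ₂} (ℝ : RealField c ℓ₁ ℓ₂) where

  open Plane ℝ
  open OrderedFieldProperties orderedField
  open RealAnalysis ℝ using (fromℕ-*-pos⁻¹; ÷-*-cancel)
  open StripCovering ℝ

  private
    scaled-≤ : ∀ {x y p} → 0# < p → p ≈ fromℕ 48 * (y - x) → x ≤ y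
    scaled-≤ 0<p eq = <⇒≤ (0<-⇒< (fromℕ-*-pos⁻¹ 48 (<-respʳ-≈ eq 0<p)))

    fromℤ-< : ∀ {i j} → i ℤ.< j → 0# ≤ fromℤ j - fromℤ i - 1#
    fromℤ-< {i} {j} i<j = ≤-trans (≤⇒0≤- (fromℤ-mono-≤ (ℤₚ.i<j⇒suc[i]≤j i<j)))
      (≤-reflexive (trans (+-congˡ (-‿cong (fromℤ-homo-+ (+ 1) i)))
        (solve 2 (λ i j → j :- (con⁺ 1 :+ con⁺ 0 :+ i) := j :- i :- con⁺ 1) refl (fromℤ i) (fromℤ j))))

    gap : ∀ {z d} → 0# < fromℕ 15 - z → 0# ≤ d → 0# < fromℕ 2 * (fromℕ 15 - z) + (fromℕ 18 + fromℕ 48 * d)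
    gap z<15 0≤d = +-pos (fromℕ-*-pos 1 z<15) (<-≤-trans (0<fromℕ 18)
      (≤-by (*-nonneg (0≤fromℕ 48) 0≤d) (solve 1 (λ d → con⁺ 48 :* d
        := con⁺ 18 :+ con⁺ 48 :* d :- con⁺ 18) refl _)))

  -- Another integer is at least 48 units from `n`, hence more than 33 from `t`, which is less than
  -- 15 from `n`. The margin 48 - 2 · 15 is the 18 in `gap`.
  near⇒isNearestInteger : ∀ {t n} → Near t n → IsNearestInteger t n
  near⇒isNearestInteger {t} {n} (l , u) m with ℤₚ.<-cmp n m
  ... | tri≈ _ n≡m _ = ≤-reflexive (∣∣-cong (+-congˡ (-‿cong (reflexive (≡.cong fromℤ n≡m)))))
  ... | tri< n<m _ _ = ≤-trans (∣∣-least
      (scaled-≤ (gap (<⇒0<- u) (fromℤ-< n<m))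
        (solve 3 (λ t n m → con⁺ 2 :* (con⁺ 15 :- con⁺ 48 :* (t :- n)) :+ (con⁺ 18 :+ con⁺ 48 :* (m :- n
          :- con⁺ 1))
          := con⁺ 48 :* (:- (t :- m) :- (t :- n))) refl t (fromℤ n) (fromℤ m)))
      (≤-by (+-nonneg (fromℤ-< n<m) (<⇒≤ 0<1))
        (solve 3 (λ t n m → m :- n :- con⁺ 1 :+ con⁺ 1
          := :- (t :- m) :- (:- (t :- n))) refl t (fromℤ n) (fromℤ m))))
    (-x≤∣x∣ (t - fromℤ m))
  ... | tri> _ _ m<n = ≤-trans (∣∣-least
      (≤-by (+-nonneg (fromℤ-< m<n) (<⇒≤ 0<1))
        (solve 3 (λ t n m → n :- m :- con⁺ 1 :+ con⁺ 1 := t :- m :- (t :- n)) refl t (fromℤ n) (fromℤ m)))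
      (scaled-≤ (gap (<-respʳ-≈ (solve 1 (λ z → z :- :- con⁺ 15
        := con⁺ 15 :- (:- z)) refl (offset t n)) (<⇒0<- l)) (fromℤ-< m<n))
        (solve 3 (λ t n m → con⁺ 2 :* (con⁺ 15 :- (:- (con⁺ 48 :* (t :- n)))) :+ (con⁺ 18
          :+ con⁺ 48 :* (n :- m :- con⁺ 1))
          := con⁺ 48 :* (t :- m :- (:- (t :- n)))) refl t (fromℤ n) (fromℤ m))))
    (x≤∣x∣ (t - fromℤ m))

  near⇒E : ∀ {x y} → ∃[ n ] Near x n → E (1# ÷ 3 - 1# ÷ 48) (x , y)
  near⇒E {x} (n , near@(l , u)) = ∣ x - fromℤ n ∣ , (n , near⇒isNearestInteger {n = n} near , refl) , ∣x-n∣≤ε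
    where
    48[i-j]≈15 : ∀ i j → i * fromℕ 3 ≈ 1# → j * fromℕ 48 ≈ 1# → fromℕ 48 * (i - j) ≈ fromℕ 15
    48[i-j]≈15 i j p q = trans
      (solve 2 (λ i j → con⁺ 48 :* (i :- j) := con⁺ 16 :* (i :* con⁺ 3) :- j :* con⁺ 48) refl i j)
      (trans (+-cong (*-congˡ p) (-‿cong q)) (solve 0 (con⁺ 16 :* con⁺ 1 :- con⁺ 1 := con⁺ 15) refl))

    -- ε is kept abstract so that unification does not unfold the division.
    bound : ∀ ε → fromℕ 48 * ε ≈ fromℕ 15 → ∣ x - fromℤ n ∣ ≤ ε
    bound ε 48ε≈15 = ∣∣-least
      (scaled-≤ (<⇒0<- u) (trans (+-congʳ (sym 48ε≈15))
        (solve 2 (λ ε z → con⁺ 48 :* ε :- con⁺ 48 :* z := con⁺ 48 :* (ε :- z)) refl ε (x - fromℤ n))))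
      (scaled-≤ (<⇒0<- l) (trans (+-congˡ (-‿cong (-‿cong (sym 48ε≈15))))
        (solve 2 (λ ε z → con⁺ 48 :* z :- :- (con⁺ 48 :* ε) := con⁺ 48 :* (ε :- (:- z))) refl ε (x - fromℤ n))))

    ∣x-n∣≤ε : ∣ x - fromℤ n ∣ ≤ 1# ÷ 3 - 1# ÷ 48
    ∣x-n∣≤ε = bound (1# ÷ 3 - 1# ÷ 48) (48[i-j]≈15 (1# ÷ 3) (1# ÷ 48) (÷-*-cancel 1# 3) (÷-*-cancel 1# 48))

-- Rotated strips and linear relations between abscissae

module RotatedStrips {c ℓ₁ ℓ₂} (ℝ : RealField c ℓ₁ ℓ₂) {cos sin : RealField.Carrier ℝ → RealField.Carrier ℝ}
  (cos-series : Plane.IsCosine ℝ cos) (sin-series : Plane.IsSine ℝ sin) where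

  open Plane ℝ
  open OrderedFieldProperties orderedField
  open ComplexNumbers commutativeRing
  open Trigonometry ℝ cos-series sin-series
  open ThirdTurn ℝ cos-series sin-series
  open StripCovering ℝ
  open NearestInteger ℝ

  -- The abscissa of R₋θ p, where z = cis θ.
  component : ℂ → Point → Carrier
  component (a , b) (x , y) = a * x + b * y

  component-cong : ∀ {z w} → z ≈ᶜ w → ∀ p → component z p ≈ component w p
  component-cong (r , s) p = +-cong (*-congʳ r) (*-congʳ s)

  near⇒∈rotatedStrip : ∀ θ p → ∃[ n ] Near (component (cis θ) p) n →
    image (rotation cos sin θ) (E (1# ÷ 3 - 1# ÷ 48)) p
  near⇒∈rotatedStrip θ (x , y) near =
    -- The preimage is the point rotated back by θ; rotating it forward multiplies both coordinates
    -- by cos² θ + sin² θ.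
    (component (cis θ) (x , y) , cos θ * y - sin θ * x) , near⇒E {y = cos θ * y - sin θ * x} near ,
    ( cancel x (solve 4 (λ c s x y → c :* (c :* x :+ s :* y) :- s :* (c :* y :- s :* x)
      := (c :* c :+ s :* s) :* x) refl (cos θ) (sin θ) x y)
    , cancel y (solve 4 (λ c s x y → s :* (c :* x :+ s :* y) :+ c :* (c :* y :- s :* x)
      := (c :* c :+ s :* s) :* y) refl (cos θ) (sin θ) x y))
    where
    cancel : ∀ x {y} → y ≈ (cos θ * cos θ + sin θ * sin θ) * x → y ≈ x
    cancel x eq = trans eq (trans (*-congʳ (cos²+sin²≈1 θ)) (*-identityˡ x))

  -- `component` is additive in the direction, and the three directions sum to w (1 + w₁ + w₂). They
  -- are given up to `_≈ᶜ_` so that the triple starting at angle 0 fits in with w = 1.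
  component-turns : ∀ {z z₁ z₂ w w₁ w₂} → z ≈ᶜ w → z₁ ≈ᶜ w *ᶜ w₁ → z₂ ≈ᶜ w *ᶜ w₂ → 1ᶜ +ᶜ w₁ +ᶜ w₂ ≈ᶜ 0ᶜ →
    ∀ p → component z p + component z₁ p + component z₂ p ≈ 0#
  component-turns {z} {z₁} {z₂} {w} {w₁} {w₂} p₀ p₁ p₂ Σ≈0 p@(x , y) = trans
    (solve 8 (λ a b c d e f x y → a :* x :+ b :* y :+ (c :* x :+ d :* y) :+ (e :* x :+ f :* y)
      := (a :+ c :+ e) :* x :+ (b :+ d :+ f) :* y) refl _ _ _ _ _ _ x y)
    (trans (+-cong (*-congʳ (proj₁ sum≈0)) (*-congʳ (proj₂ sum≈0))) (trans (+-cong (zeroˡ x) (zeroˡ y))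
      (+-identityˡ 0#)))
    where
    sum≈0 : z +ᶜ z₁ +ᶜ z₂ ≈ᶜ 0ᶜ
    sum≈0 = ℂ.trans (ℂ.+-cong (ℂ.+-cong p₀ p₁) p₂)
      (ℂ.trans (solveᶜ 3 (λ w w₁ w₂ → w :+ᶜ w :*ᶜ w₁ :+ᶜ w :*ᶜ w₂
          :=ᶜ w :*ᶜ (conᶜ (+ 1) :+ᶜ w₁ :+ᶜ w₂)) ℂ.refl w w₁ w₂)
        (ℂ.trans (ℂ.*-congˡ {w} Σ≈0) (ℂ.zeroʳ w)))

  -- The imaginary parts of `z` and `z′` cancel and their real parts add up to 2/3, so the
  -- directions z t and z′ t sum to (2/3) t.
  component-pair : ∀ {u v w z z′ t} → u ≈ᶜ t → v ≈ᶜ z *ᶜ t → w ≈ᶜ z′ *ᶜ t →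
    fromℕ 3 * (proj₁ z + proj₁ z′) ≈ fromℕ 2 → proj₂ z + proj₂ z′ ≈ 0# →
    ∀ p → fromℕ 3 * (component v p + component w p) ≈ fromℕ 2 * component u p
  component-pair {z = a , b} {a′ , b′} {c , d} u≈ v≈ w≈ re im p@(x , y) = trans
    (*-congˡ (+-cong (component-cong v≈ p) (component-cong w≈ p)))
    (trans (solve 8 (λ a b a′ b′ c d x y →
        con⁺ 3 :* ((a :* c :- b :* d) :* x :+ (a :* d :+ b :* c) :* y
          :+ ((a′ :* c :- b′ :* d) :* x :+ (a′ :* d :+ b′ :* c) :* y))
        := con⁺ 3 :* (a :+ a′) :* (c :* x :+ d :* y) :+ (b :+ b′) :* (con⁺ 3 :* (c :* y :- d :* x)))
          refl a b a′ b′ c d x y)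
      (trans (+-cong (*-congʳ re) (trans (*-congʳ im) (zeroˡ _)))
        (trans (+-identityʳ _) (*-congˡ (sym (component-cong u≈ p))))))

-- Covering the plane by the nine rotated strips

theorem3p1 : ∀ {c ℓ₁ ℓ₂} (ℝ : RealField c ℓ₁ ℓ₂) → let open Plane ℝ in
    (cos sin : Carrier → Carrier) → IsCosine cos → IsSine sin →
    (π : Carrier) → IsPi sin π →
    (√8 : Carrier) → √8 IsSqrtOf fromℕ 8 →
    (θ₄ : Carrier) → cos θ₄ ≈ 1# ÷ 3 → sin θ₄ ≈ √8 ÷ 3 →
    (θ₇ : Carrier) → cos θ₇ ≈ 1# ÷ 3 → sin θ₇ ≈ - (√8 ÷ 3) →
    let ε = 1# ÷ 3 - 1# ÷ 48 in
    ⋃ (Fin 9) (λ j → image (rotation cos sin (angles π θ₄ θ₇ j)) (E ε)) ≐ U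
theorem3p1 ℝ cos sin cos-series sin-series π isPi √8 _ θ₄ cosθ₄ sinθ₄ θ₇ cosθ₇ sinθ₇ = (λ _ → tt) , λ {p} _ → covered p
  where
  open Plane ℝ
  open OrderedFieldProperties orderedField
  open ComplexNumbers commutativeRing
  open RealAnalysis ℝ using (÷-*-cancel)
  open Trigonometry ℝ cos-series sin-series
  open ThirdTurn ℝ cos-series sin-series
  open StripCovering ℝ
  open RotatedStrips ℝ cos-series sin-series

  third₁ third₂ : Carrier
  third₁ = 2π/3 isPi
  third₂ = 4π/3 isPi

  turns≈0 : 1ᶜ +ᶜ cis third₁ +ᶜ cis third₂ ≈ᶜ 0ᶜ
  turns≈0 = ℂ.trans (ℂ.+-congˡ {1ᶜ +ᶜ cis third₁} (cis-4π/3 isPi)) (1+ω+ω²≈0 isPi)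

  component-turns-at : ∀ θ p →
    component (cis θ) p + component (cis (θ + third₁)) p + component (cis (θ + third₂)) p ≈ 0#
  component-turns-at θ = component-turns {w = cis θ} ℂ.refl (cis-+ θ third₁) (cis-+ θ third₂) turns≈0

  re-sum : fromℕ 3 * (cos θ₄ + cos θ₇) ≈ fromℕ 2
  re-sum = trans (*-congˡ (+-cong cosθ₄ cosθ₇)) (double (1# ÷ 3) (÷-*-cancel 1# 3))
    where
    double : ∀ x → x * fromℕ 3 ≈ 1# → fromℕ 3 * (x + x) ≈ fromℕ 2
    double x p = trans (solve 1 (λ x → con⁺ 3 :* (x :+ x) := x :* con⁺ 3 :+ x :* con⁺ 3) refl x)
      (trans (+-cong p p) (solve 0 (con⁺ 1 :+ con⁺ 1 := con⁺ 2) refl))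

  im-sum : sin θ₄ + sin θ₇ ≈ 0#
  im-sum = trans (+-cong sinθ₄ sinθ₇) (-‿inverseʳ (√8 ÷ 3))

  component-pair-at : ∀ φ p →
    fromℕ 3 * (component (cis (θ₄ + φ)) p + component (cis (θ₇ + φ)) p) ≈ fromℕ 2 * component (cis φ) p
  component-pair-at φ = component-pair {z = cis θ₄} {cis θ₇} {cis φ} ℂ.refl (cis-+ θ₄ φ) (cis-+ θ₇ φ) re-sum im-sum

  component-pair-at-0 : ∀ p →
    fromℕ 3 * (component (cis θ₄) p + component (cis θ₇) p) ≈ fromℕ 2 * component (cis 0#) p
  component-pair-at-0 = component-pair {z = cis θ₄} {cis θ₇} {1ᶜ} cis-0
    (ℂ.sym (ℂ.*-identityʳ (cis θ₄))) (ℂ.sym (ℂ.*-identityʳ (cis θ₇))) re-sum im-sum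

  Covered : Point → Set _
  Covered p = ⋃ (Fin 9) (λ j → image (rotation cos sin (angles π θ₄ θ₇ j)) (E (1# ÷ 3 - 1# ÷ 48))) p

  covered : ∀ p → Covered p
  covered p = decide
    (near-or-closeToThirds _ _ _ (component-turns {w = 1ᶜ} cis-0 (ℂ.sym (ℂ.*-identityˡ (cis third₁)))
      (ℂ.sym (ℂ.*-identityˡ (cis third₂))) turns≈0 p))
    (near-or-closeToThirds _ _ _ (component-turns-at θ₄ p))
    (near-or-closeToThirds _ _ _ (component-turns-at θ₇ p))
    where
    N : Carrier → Set _
    N θ = ∃[ n ] Near (component (cis θ) p) n

    strip : ∀ j → N (angles π θ₄ θ₇ j) → Covered p
    strip j near = j , near⇒∈rotatedStrip (angles π θ₄ θ₇ j) p near

    T : Carrier → Carrier → Carrier → Set _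
    T θ θ′ θ″ = CloseToThirds (component (cis θ) p) (component (cis θ′) p) (component (cis θ″) p)

    decide : (N 0# ⊎ N third₁ ⊎ N third₂) ⊎ T 0# third₁ third₂ →
      (N θ₄ ⊎ N (θ₄ + third₁) ⊎ N (θ₄ + third₂)) ⊎ T θ₄ (θ₄ + third₁) (θ₄ + third₂) →
      (N θ₇ ⊎ N (θ₇ + third₁) ⊎ N (θ₇ + third₂)) ⊎ T θ₇ (θ₇ + third₁) (θ₇ + third₂) → Covered p
    decide (inj₁ (inj₁ near))        _ _ = strip 0F near
    decide (inj₁ (inj₂ (inj₁ near))) _ _ = strip 1F near
    decide (inj₁ (inj₂ (inj₂ near))) _ _ = strip 2F near
    decide _ (inj₁ (inj₁ near))        _ = strip 3F near
    decide _ (inj₁ (inj₂ (inj₁ near))) _ = strip 4F near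
    decide _ (inj₁ (inj₂ (inj₂ near))) _ = strip 5F near
    decide _ _ (inj₁ (inj₁ near))        = strip 6F near
    decide _ _ (inj₁ (inj₂ (inj₁ near))) = strip 7F near
    decide _ _ (inj₁ (inj₂ (inj₂ near))) = strip 8F near
    decide (inj₂ close) (inj₂ close₄) (inj₂ close₇) = ⊥-elim
      (closeToThirds-incompatible (component-pair-at-0 p) (component-pair-at third₁ p) (component-pair-at third₂ p)
        close close₄ close₇)
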